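{- Let $n\ge 2k+2$ and $k\ge 4$ be integers, and let $\mathcal{F}_1,\mathcal{F}_2,\dots,\mathcal{F}_h\subseteq\binom{[n]}{k}$ be families of $k$-element subsets of $[n]=\{1,\dots,n\}$ such that: (i) $\mathcal{F}_i\cap\mathcal{F}_j=\emptyset$ for all $1\le i<j\le h$; (ii) $F\cap F'=\emptyset$ for every $i\in\{1,\dots,h\}$ and every pair of distinct sets $F,F'\in\mathcal{F}_i$; (iii) $F_i\cap F_j\neq\emptyset$ for all $1\le i<j\le h$ and all $F_i\in\mathcal{F}_i$, $F_j\in\mathcal{F}_j$. Then $\sum_{i=1}^h|\mathcal{F}_i|\le\binom{n-1}{k-1}$. -}

module Defs where

open import Data.Nat using (ℕ)
open import Data.Fin using (Fin)
open import Data.Fin.Subset using (Subset; ∣_∣; _∩_; ⊥)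
open import Data.List using (List; length; map; allFin)
open import Data.Nat.ListAction using (sum)
open import Data.List.Membership.Propositional using (_∈_)
open import Data.List.Relation.Unary.All using (All)
open import Relation.Binary.PropositionalEquality using (_≡_; _≢_)
open import Relation.Nullary using (¬_)

-- A family of subsets of [n] is represented as a duplicate-free list of subsets,
-- so that its cardinality is the length of the list.
Family : ℕ → Set
Family n = List (Subset n)

IsKUniform : ∀ {n} → ℕ → Family n → Set
IsKUniform k 𝓕 = All (λ F → ∣ F ∣ ≡ k) 𝓕

DisjointFamilies : ∀ {n} → Family n → Family n → Set
DisjointFamilies 𝓕 𝓖 = ∀ F → F ∈ 𝓕 → ¬ (F ∈ 𝓖)

PairwiseDisjointMembers : ∀ {n} → Family n → Set
PairwiseDisjointMembers 𝓕 = ∀ F F′ → F ∈ 𝓕 → F′ ∈ 𝓕 → F ≢ F′ → F ∩ F′ ≡ ⊥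

CrossIntersecting : ∀ {n} → Family n → Family n → Set
CrossIntersecting 𝓕 𝓖 = ∀ F G → F ∈ 𝓕 → G ∈ 𝓖 → F ∩ G ≢ ⊥

totalSize : ∀ {n h} → (Fin h → Family n) → ℕ
totalSize {h = h} 𝓕 = sum (map (λ i → length (𝓕 i)) (allFin h))

{-# OPTIONS --safe #-}
module Submission where

-- Katona's cycle method combined with Bollobás' set-pair argument. Call a member of the union of the
-- families isolated if it meets every member, and otherwise fix a mate disjoint from it. In a cyclic order
-- of [n], give weight n to each isolated member that is an arc, and weight k to each cut from which a
-- non-isolated A comes entirely before its mate, starting with an element of A. If no isolated member
-- is an arc, every cut carries weight at most k, because all other intersections between two separated pairs
-- are nonempty. If the isolated F is an arc, each separated pair meets F on both sides, so one of its two
-- gaps lies at one of the k - 1 cuts inside F, and each of these cuts is used either by one isolated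
-- arc or by at most two members of weight k ≤ n/2. Hence the total weight of a cyclic order is at most nk,
-- and averaging over all orders gives the bound provided n² C(2k-1,k) ≤ k² C(n,k). This holds for
-- n ≥ 2k + 2 and k ≥ 4 except when (n,k) = (10,4), where a further weight e = 1 is given to the cut one
-- step earlier when the element stepped over lies outside both A and its mate.

open import Defs
open import Data.Nat using (ℕ; _≤_; _+_; _*_; _∸_)
open import Data.Nat.Combinatorics using (_C_)
open import Data.Fin using (Fin)
open import Data.List.Relation.Unary.Unique.Propositional using (Unique)

open import Data.Bool using (Bool; true; false; _∧_; not; if_then_else_)
import Data.Bool.Properties as Bool
open import Data.Empty using (⊥; ⊥-elim)
open import Data.Fin using (zero; suc)
import Data.Fin.Properties as Fin
open import Data.Fin.Subset using (Subset; ∣_∣; _∩_; _⊆_) renaming (⊥ to ∅; _∈_ to _∈ˢ_)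
open import Data.Fin.Subset.Properties using (p⊂q⇒∣p∣<∣q∣; ⊆-antisym; _∈?_; nonempty?; Empty-unique; ∣⊥∣≡0; ∉⊥; x∈p∩q⁺; x∈p∩q⁻)
open import Data.List using (List; []; _∷_; _++_; _∷ʳ_; map; concatMap; length; applyUpTo; upTo; allFin; tabulate)
open import Data.List.Membership.Propositional using (_∈_; find; lose)
open import Data.List.Membership.Propositional.Properties using (∈-map⁻; ∈-concatMap⁻; ∈-upTo⁺; ∈-upTo⁻; ∈-allFin)
open import Data.List.Properties using (map-++; map-upTo; map-tabulate; length-tabulate; length-upTo; applyUpTo-∷ʳ)
open import Data.List.Relation.Binary.Permutation.Propositional using (_↭_; prep; swap; ↭-refl; ↭-trans; ↭-sym; ↭⇒↭ₛ)
open import Data.List.Relation.Binary.Permutation.Propositional.Properties using (↭-length; ∈-resp-↭) renaming (map⁺ to ↭-map⁺)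
open import Data.List.Relation.Binary.Permutation.Setoid.Properties using (Unique-resp-↭)
import Data.List.Relation.Unary.All as All
import Data.List.Relation.Unary.All.Properties as All
open import Data.List.Relation.Unary.AllPairs using ([]; _∷_)
import Data.List.Relation.Unary.AllPairs.Properties as AllPairs
open import Data.List.Relation.Unary.Any using (Any; here; there; any?)
open import Data.List.Relation.Unary.Unique.Propositional.Properties using (concat⁺; upTo⁺; allFin⁺)
open import Data.Nat using (zero; suc; _!; z≤n; s≤s; z<s; s<s; _<?_; _≤?_)
open import Data.Nat.Combinatorics using (nCk≡n!/k![n-k]!)
open import Data.Nat.DivMod using (_%_; _/_; [m+n]%n≡m%n; m<n⇒m%n≡m; /-monoˡ-≤; /-congʳ; m*n/n≡m)
open import Data.Nat.ListAction using (sum)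
open import Data.Nat.ListAction.Properties using (sum-++; sum-↭)
open import Data.Nat.Properties
open import Data.Nat.Tactic.RingSolver using (solve-∀)
open import Data.Product using (_×_; _,_; proj₁; proj₂; ∃)
open import Data.Sum using (_⊎_; inj₁; inj₂)
open import Data.Vec using (lookup; []; _∷_)
open import Data.Vec.Properties using ([]=⇒lookup; lookup⇒[]=; ≡-dec)
open import Function using (_∘_)
open import Relation.Binary.Definitions using (tri<; tri≈; tri>)
open import Relation.Binary.PropositionalEquality using (_≡_; _≢_; refl; sym; cong; cong₂; subst; subst₂; setoid; module ≡-Reasoning) renaming (trans to ≡-trans)
open import Relation.Nullary using (¬_; Dec; yes; no; _×-dec_)

-- The families enter through one property: two disjoint members belong to the same family, so among
-- distinct members disjointness is transitive. Hence, if two distinct non-isolated members meet,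
-- each also meets the other's mate. Requiring the line to start in A serves two ends: members
-- leading at one cut share its first element, and a member leads at most once around the circle.
-- The weights are balanced so that both kinds of cyclic order give nk: n cuts of weight k, or n for
-- the start of F and n for each of the k - 1 cuts inside F. In a random ordering an isolated member
-- has expected weight n / C(n,k), and leading alone gives any other member k (k/n) / C(2k-1,k): the
-- first letter lies in A with probability k/n, and then the other k - 1 letters of A must precede
-- the k letters of the mate. The numerical condition compares these two means. At (10,4) it would
-- read 3500 ≤ 3360. A pair may weigh k + e altogether as long as 2(k + e) ≤ n, which leaves room
-- for exactly e = 1 there.

module WeightedCycles where
  open import Data.Nat using (_<_)

  private variable
    X Y : Set

  -- Finite sums over lists

  ∑ : List X → (X → ℕ) → ℕ
  ∑ xs f = sum (map f xs)

  ⟦_⟧ : Bool → ℕ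
  ⟦ true ⟧ = 1
  ⟦ false ⟧ = 0

  ∑-cong∈ : (xs : List X) {f g : X → ℕ} → (∀ {x} → x ∈ xs → f x ≡ g x) → ∑ xs f ≡ ∑ xs g
  ∑-cong∈ [] h = refl
  ∑-cong∈ (x ∷ xs) h = cong₂ _+_ (h (here refl)) (∑-cong∈ xs (h ∘ there))

  ∑-cong : (xs : List X) {f g : X → ℕ} → (∀ x → f x ≡ g x) → ∑ xs f ≡ ∑ xs g
  ∑-cong xs h = ∑-cong∈ xs (λ {x} _ → h x)

  ∑-mono : (xs : List X) {f g : X → ℕ} → (∀ {x} → x ∈ xs → f x ≤ g x) → ∑ xs f ≤ ∑ xs g
  ∑-mono [] h = z≤n
  ∑-mono (x ∷ xs) h = +-mono-≤ (h (here refl)) (∑-mono xs (h ∘ there))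

  ∑-+ : (xs : List X) (f g : X → ℕ) → ∑ xs (λ x → f x + g x) ≡ ∑ xs f + ∑ xs g
  ∑-+ [] f g = refl
  ∑-+ (x ∷ xs) f g rewrite ∑-+ xs f g = interchange (f x) (g x) (∑ xs f) (∑ xs g)
    where
    interchange : ∀ a b c d → (a + b) + (c + d) ≡ (a + c) + (b + d)
    interchange = solve-∀

  ∑-*ˡ : (xs : List X) (c : ℕ) (f : X → ℕ) → ∑ xs (λ x → c * f x) ≡ c * ∑ xs f
  ∑-*ˡ [] c f = sym (*-zeroʳ c)
  ∑-*ˡ (x ∷ xs) c f rewrite ∑-*ˡ xs c f = sym (*-distribˡ-+ c (f x) _)

  ∑-*ʳ : (xs : List X) (c : ℕ) (f : X → ℕ) → ∑ xs (λ x → f x * c) ≡ ∑ xs f * c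
  ∑-*ʳ [] c f = refl
  ∑-*ʳ (x ∷ xs) c f rewrite ∑-*ʳ xs c f = sym (*-distribʳ-+ c (f x) _)

  ∑-const : (xs : List X) (c : ℕ) → ∑ xs (λ _ → c) ≡ length xs * c
  ∑-const [] c = refl
  ∑-const (x ∷ xs) c = cong (c +_) (∑-const xs c)

  ∑-zero : (xs : List X) {f : X → ℕ} → (∀ {x} → x ∈ xs → f x ≡ 0) → ∑ xs f ≡ 0
  ∑-zero [] h = refl
  ∑-zero (x ∷ xs) h rewrite h (here refl) = ∑-zero xs (h ∘ there)

  ∑-comm : (xs : List X) (ys : List Y) (f : X → Y → ℕ) →
    ∑ xs (λ x → ∑ ys (f x)) ≡ ∑ ys (λ y → ∑ xs (λ x → f x y))
  ∑-comm [] ys f = sym (∑-zero ys (λ _ → refl))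
  ∑-comm (x ∷ xs) ys f rewrite ∑-comm xs ys f = sym (∑-+ ys (f x) _)

  ∑-++ : (xs ys : List X) (f : X → ℕ) → ∑ (xs ++ ys) f ≡ ∑ xs f + ∑ ys f
  ∑-++ xs ys f rewrite map-++ f xs ys = sum-++ (map f xs) (map f ys)

  ∑-map : (h : Y → X) (ys : List Y) (f : X → ℕ) → ∑ (map h ys) f ≡ ∑ ys (f ∘ h)
  ∑-map h [] f = refl
  ∑-map h (y ∷ ys) f = cong (f (h y) +_) (∑-map h ys f)

  ∑-concatMap : (h : Y → List X) (ys : List Y) (f : X → ℕ) →
    ∑ (concatMap h ys) f ≡ ∑ ys (λ y → ∑ (h y) f)
  ∑-concatMap h [] f = refl
  ∑-concatMap h (y ∷ ys) f =
    ≡-trans (∑-++ (h y) (concatMap h ys) f) (cong (∑ (h y) f +_) (∑-concatMap h ys f))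

  ∑-⟦⟧-positive : (xs : List X) (p : X → Bool) →
    ∑ xs (λ x → ⟦ p x ⟧) ≡ 0 ⊎ (∃ λ x → x ∈ xs × p x ≡ true)
  ∑-⟦⟧-positive [] p = inj₁ refl
  ∑-⟦⟧-positive (x ∷ xs) p with p x in eq | ∑-⟦⟧-positive xs p
  ... | true  | _ = inj₂ (x , here refl , eq)
  ... | false | inj₁ z = inj₁ z
  ... | false | inj₂ (y , y∈ , py) = inj₂ (y , there y∈ , py)

  ∑-⟦⟧≤1 : (xs : List X) → Unique xs → (p : X → Bool) →
    (∀ {x y} → x ∈ xs → y ∈ xs → p x ≡ true → p y ≡ true → x ≡ y) →
    ∑ xs (λ x → ⟦ p x ⟧) ≤ 1
  ∑-⟦⟧≤1 [] _ p h = z≤n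
  ∑-⟦⟧≤1 (x ∷ xs) (x∉ ∷ u) p h with p x in eq
  ... | false = ∑-⟦⟧≤1 xs u p (λ a b → h (there a) (there b))
  ... | true with ∑-⟦⟧-positive xs p
  ...   | inj₁ z = s≤s (≤-reflexive z)
  ...   | inj₂ (y , y∈ , py) = ⊥-elim (All.lookup x∉ y∈ (h (here refl) (there y∈) eq py))

  ∈-∑ : {xs : List X} {x : X} (f : X → ℕ) → x ∈ xs → f x ≤ ∑ xs f
  ∈-∑ f (here refl) = m≤m+n _ _
  ∈-∑ f (there x∈) = ≤-trans (∈-∑ f x∈) (m≤n+m _ _)

  -- Orderings of a list

  picks : List X → List (X × List X)
  picks [] = []
  picks (x ∷ xs) = (x , xs) ∷ map (λ (y , ys) → y , x ∷ ys) (picks xs)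

  -- The length is a separate argument because the remainders delivered by `picks` are not
  -- structurally smaller than the list.
  orderings : ℕ → List X → List (List X)
  orderings zero xs = [] ∷ []
  orderings (suc m) xs = concatMap (λ (x , ys) → map (x ∷_) (orderings m ys)) (picks xs)

  ∑-orderings : ∀ m (xs : List X) (f : List X → ℕ) →
    ∑ (orderings (suc m) xs) f ≡ ∑ (picks xs) (λ (x , ys) → ∑ (orderings m ys) (λ l → f (x ∷ l)))
  ∑-orderings m xs f = ≡-trans
    (∑-concatMap (λ (x , ys) → map (x ∷_) (orderings m ys)) (picks xs) f)
    (∑-cong (picks xs) (λ (x , ys) → ∑-map (x ∷_) (orderings m ys) f))

  ∑-picks : (xs : List X) (f : X → ℕ) → ∑ (picks xs) (f ∘ proj₁) ≡ ∑ xs f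
  ∑-picks [] f = refl
  ∑-picks (x ∷ xs) f = cong (f x +_) (≡-trans (∑-map _ (picks xs) (f ∘ proj₁)) (∑-picks xs f))

  picks-↭ : {xs : List X} {y : X} {ys : List X} → (y , ys) ∈ picks xs → y ∷ ys ↭ xs
  picks-↭ {xs = x ∷ xs} (here refl) = ↭-refl
  picks-↭ {xs = x ∷ xs} (there p) with ∈-map⁻ _ p
  ... | (y , ys) , q , refl = ↭-trans (swap y x ↭-refl) (prep x (picks-↭ q))

  picks-length : ∀ {m} {xs : List X} {y : X} {ys : List X} → length xs ≡ suc m →
    (y , ys) ∈ picks xs → length ys ≡ m
  picks-length e p = suc-injective (≡-trans (↭-length (picks-↭ p)) e)

  ∑-↭ : (f : X → ℕ) {xs ys : List X} → xs ↭ ys → ∑ xs f ≡ ∑ ys f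
  ∑-↭ f p = sum-↭ (↭-map⁺ f p)

  orderings-↭ : ∀ m (xs : List X) {l} → length xs ≡ m → l ∈ orderings m xs → l ↭ xs
  orderings-↭ zero [] e (here refl) = ↭-refl
  orderings-↭ (suc m) xs {l} e l∈ = go (∈-concatMap⁻ step {xs = picks xs} l∈)
    where
    step : _ → _
    step (x , ys) = map (x ∷_) (orderings m ys)
    go′ : ∀ {p} → p ∈ picks xs → l ∈ step p → l ↭ xs
    go′ {x , ys} p∈ q with ∈-map⁻ _ q
    ... | l′ , l′∈ , refl =
      ↭-trans (prep x (orderings-↭ m ys (picks-length e p∈) l′∈)) (picks-↭ p∈)
    go : Any (λ p → l ∈ step p) (picks xs) → l ↭ xs
    go a with find a
    ... | p , p∈ , q = go′ p∈ q

  ∑-orderings-1 : ∀ m (xs : List X) → length xs ≡ m → ∑ (orderings m xs) (λ _ → 1) ≡ m !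
  ∑-orderings-1 zero xs e = refl
  ∑-orderings-1 (suc m) xs e = begin
    ∑ (orderings (suc m) xs) (λ _ → 1)
      ≡⟨ ∑-orderings m xs _ ⟩
    ∑ (picks xs) (λ (x , ys) → ∑ (orderings m ys) (λ _ → 1))
      ≡⟨ ∑-cong∈ (picks xs) (λ {p} p∈ → ∑-orderings-1 m (proj₂ p) (picks-length e p∈)) ⟩
    ∑ (picks xs) (λ _ → m !)
      ≡⟨ ∑-picks xs (λ _ → m !) ⟩
    ∑ xs (λ _ → m !)
      ≡⟨ ∑-const xs (m !) ⟩
    length xs * m !
      ≡⟨ cong (_* m !) e ⟩
    suc m * m ! ∎
    where open ≡-Reasoning

  -- Of two successive picks the head `x` is the first (`P`), the second (`Q`) or neither (`R`).
  -- Exchanging the picks swaps `P` with `Q`, and `R` is covered by induction on the tail.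
  ∑-picks-swap : (xs : List X) (g : X → X → List X → ℕ) →
    ∑ (picks xs) (λ (x , ys) → ∑ (picks ys) (λ (y , zs) → g x y zs)) ≡
    ∑ (picks xs) (λ (x , ys) → ∑ (picks ys) (λ (y , zs) → g y x zs))
  ∑-picks-swap [] g = refl
  ∑-picks-swap {X = X} (x ∷ xs) g = begin
    ∑ (picks (x ∷ xs)) (λ (x , ys) → ∑ (picks ys) (λ (y , zs) → g x y zs))
      ≡⟨ expand g ⟩
    P + (Q + R)
      ≡⟨ rearrange P Q R ⟩
    Q + (P + R)
      ≡⟨ cong (λ r → Q + (P + r)) (∑-picks-swap xs (λ y z zs → g y z (x ∷ zs))) ⟩
    Q + (P + R′)
      ≡⟨ expand (λ y x → g x y) ⟨
    ∑ (picks (x ∷ xs)) (λ (x , ys) → ∑ (picks ys) (λ (y , zs) → g y x zs)) ∎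
    where
    open ≡-Reasoning
    P Q R R′ : ℕ
    P = ∑ (picks xs) (λ (y , ys) → g x y ys)
    Q = ∑ (picks xs) (λ (y , ys) → g y x ys)
    R = ∑ (picks xs) (λ (y , ys) → ∑ (picks ys) (λ (z , zs) → g y z (x ∷ zs)))
    R′ = ∑ (picks xs) (λ (y , ys) → ∑ (picks ys) (λ (z , zs) → g z y (x ∷ zs)))
    rearrange : ∀ a b c → a + (b + c) ≡ b + (a + c)
    rearrange = solve-∀
    expand : ∀ (g : X → X → List X → ℕ) →
      ∑ (picks (x ∷ xs)) (λ (x , ys) → ∑ (picks ys) (λ (y , zs) → g x y zs)) ≡
      ∑ (picks xs) (λ (y , ys) → g x y ys) +
        (∑ (picks xs) (λ (y , ys) → g y x ys) +
         ∑ (picks xs) (λ (y , ys) → ∑ (picks ys) (λ (z , zs) → g y z (x ∷ zs))))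
    expand g = cong (∑ (picks xs) (λ (y , ys) → g x y ys) +_) (begin
      ∑ (map (λ (y , ys) → y , x ∷ ys) (picks xs)) (λ (y , ys) → ∑ (picks ys) (λ (z , zs) → g y z zs))
        ≡⟨ ∑-map _ (picks xs) _ ⟩
      ∑ (picks xs) (λ (y , ys) → g y x ys + ∑ (map (λ (z , zs) → z , x ∷ zs) (picks ys)) (λ (z , zs) → g y z zs))
        ≡⟨ ∑-cong (picks xs) (λ (y , ys) → cong (g y x ys +_) (∑-map _ (picks ys) _)) ⟩
      ∑ (picks xs) (λ (y , ys) → g y x ys + ∑ (picks ys) (λ (z , zs) → g y z (x ∷ zs)))
        ≡⟨ ∑-+ (picks xs) _ _ ⟩
      _ ∎)

  -- Exchanging the last letter with the first letter of `l` puts the letter picked first in front;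
  -- the other one is then moved to the front of the shorter word by induction. This makes sums over
  -- all orderings invariant under rotation.
  ∑-orderings-∷ʳ : ∀ m (xs : List X) (g : List X → ℕ) →
    ∑ (picks xs) (λ (x , ys) → ∑ (orderings m ys) (λ l → g (l ∷ʳ x))) ≡
    ∑ (picks xs) (λ (x , ys) → ∑ (orderings m ys) (λ l → g (x ∷ l)))
  ∑-orderings-∷ʳ zero xs g = refl
  ∑-orderings-∷ʳ (suc m) xs g = begin
    ∑ (picks xs) (λ (x , ys) → ∑ (orderings (suc m) ys) (λ l → g (l ∷ʳ x)))
      ≡⟨ ∑-cong (picks xs) (λ (x , ys) → ∑-orderings m ys _) ⟩
    ∑ (picks xs) (λ (x , ys) → ∑ (picks ys) (λ (y , zs) → ∑ (orderings m zs) (λ l → g (y ∷ l ∷ʳ x))))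
      ≡⟨ ∑-picks-swap xs (λ x y zs → ∑ (orderings m zs) (λ l → g (y ∷ l ∷ʳ x))) ⟩
    ∑ (picks xs) (λ (x , ys) → ∑ (picks ys) (λ (y , zs) → ∑ (orderings m zs) (λ l → g (x ∷ l ∷ʳ y))))
      ≡⟨ ∑-cong (picks xs) (λ (x , ys) → ∑-orderings-∷ʳ m ys (λ l → g (x ∷ l))) ⟩
    ∑ (picks xs) (λ (x , ys) → ∑ (picks ys) (λ (y , zs) → ∑ (orderings m zs) (λ l → g (x ∷ y ∷ l))))
      ≡⟨ ∑-cong (picks xs) (λ (x , ys) → ∑-orderings m ys _) ⟨
    ∑ (picks xs) (λ (x , ys) → ∑ (orderings (suc m) ys) (λ l → g (x ∷ l))) ∎
    where open ≡-Reasoning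

  rotate : List X → List X
  rotate [] = []
  rotate (x ∷ l) = l ∷ʳ x

  ∑-orderings-rotate : ∀ m (xs : List X) (g : List X → ℕ) →
    ∑ (orderings m xs) (g ∘ rotate) ≡ ∑ (orderings m xs) g
  ∑-orderings-rotate zero xs g = refl
  ∑-orderings-rotate (suc m) xs g = ≡-trans (∑-orderings m xs (g ∘ rotate))
    (≡-trans (∑-orderings-∷ʳ m xs g) (sym (∑-orderings m xs g)))

  rotateBy : ℕ → List X → List X
  rotateBy zero l = l
  rotateBy (suc i) l = rotateBy i (rotate l)

  ∑-orderings-rotateBy : ∀ i m (xs : List X) (g : List X → ℕ) →
    ∑ (orderings m xs) (g ∘ rotateBy i) ≡ ∑ (orderings m xs) g
  ∑-orderings-rotateBy zero m xs g = refl
  ∑-orderings-rotateBy (suc i) m xs g =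
    ≡-trans (∑-orderings-rotate m xs (g ∘ rotateBy i)) (∑-orderings-rotateBy i m xs g)

  -- Counting orderings by pattern

  count : (X → Bool) → List X → ℕ
  count a l = ∑ l (λ x → ⟦ a x ⟧)

  none : (X → Bool) → List X → Bool
  none a [] = true
  none a (x ∷ l) = not (a x) ∧ none a l

  none-count : (a : X → Bool) (l : List X) → count a l ≡ 0 → none a l ≡ true
  none-count a [] e = refl
  none-count a (x ∷ l) e with a x
  ... | false = none-count a l e

  count-none : (a : X → Bool) (l : List X) → none a l ≡ true → count a l ≡ 0
  count-none a [] e = refl
  count-none a (x ∷ l) e with a x
  ... | false = count-none a l e

  prefixIs : (X → Bool) → ℕ → List X → Bool
  prefixIs a zero l = none a l
  prefixIs a (suc k) [] = false
  prefixIs a (suc k) (x ∷ l) = a x ∧ prefixIs a k l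

  before : (X → Bool) → (X → Bool) → List X → Bool
  before a b [] = true
  before a b (x ∷ l) = if b x then none a (x ∷ l) else before a b l

  leads : (X → Bool) → (X → Bool) → List X → Bool
  leads a b [] = false
  leads a b (x ∷ l) = a x ∧ before a b l

  neither : (X → Bool) → (X → Bool) → X → Bool
  neither a b x = not (a x) ∧ not (b x)

  leadsSecond : (X → Bool) → (X → Bool) → List X → Bool
  leadsSecond a b [] = false
  leadsSecond a b (x ∷ l) = neither a b x ∧ leads a b l

  picks-count : (a : X → Bool) {xs : List X} {y : X} {ys : List X} → (y , ys) ∈ picks xs →
    ⟦ a y ⟧ + count a ys ≡ count a xs
  picks-count a p = ∑-↭ _ (picks-↭ p)

  -- The factor F clears denominators.
  ∑-orderings-head : ∀ m (xs : List X) (c : X → Bool) (f : List X → Bool) (F v : ℕ) →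
    (∀ {x ys} → (x , ys) ∈ picks xs → c x ≡ true → ∑ (orderings m ys) (λ l → ⟦ f l ⟧) * F ≡ v) →
    ∑ (picks xs) (λ (x , ys) → ∑ (orderings m ys) (λ l → ⟦ c x ∧ f l ⟧)) * F ≡ count c xs * v
  ∑-orderings-head m xs c f F v h = begin
    ∑ (picks xs) (λ (x , ys) → ∑ (orderings m ys) (λ l → ⟦ c x ∧ f l ⟧)) * F
      ≡⟨ ∑-*ʳ (picks xs) F _ ⟨
    ∑ (picks xs) (λ (x , ys) → ∑ (orderings m ys) (λ l → ⟦ c x ∧ f l ⟧) * F)
      ≡⟨ ∑-cong∈ (picks xs) step ⟩
    ∑ (picks xs) (λ (x , ys) → ⟦ c x ⟧ * v)
      ≡⟨ ∑-picks xs _ ⟩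
    ∑ xs (λ x → ⟦ c x ⟧ * v)
      ≡⟨ ∑-*ʳ xs v _ ⟩
    count c xs * v ∎
    where
    open ≡-Reasoning
    step : ∀ {p} → p ∈ picks xs →
      ∑ (orderings m (proj₂ p)) (λ l → ⟦ c (proj₁ p) ∧ f l ⟧) * F ≡ ⟦ c (proj₁ p) ⟧ * v
    step {x , ys} p∈ with c x in eq
    ... | true = ≡-trans (h p∈ eq) (sym (+-identityʳ v))
    ... | false = cong (_* F) (∑-zero (orderings m ys) (λ _ → refl))

  ∑-orderings-none : ∀ m (xs : List X) (a : X → Bool) → length xs ≡ m → count a xs ≡ 0 →
    ∑ (orderings m xs) (λ l → ⟦ none a l ⟧) ≡ m !
  ∑-orderings-none m xs a e c = ≡-trans
    (∑-cong∈ (orderings m xs) (λ {l} l∈ →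
      cong ⟦_⟧ (none-count a l (≡-trans (∑-↭ _ (orderings-↭ m xs e l∈)) c))))
    (∑-orderings-1 m xs e)

  picks-count-pred : ∀ {k} (a : X → Bool) {xs : List X} {y : X} {ys : List X} → (y , ys) ∈ picks xs →
    count a xs ≡ suc k → a y ≡ true → count a ys ≡ k
  picks-count-pred a {y = y} p∈ c eq with a y | picks-count a p∈
  picks-count-pred a {y = y} p∈ c refl | true | e = suc-injective (≡-trans e c)

  picks-count-same : ∀ {k} (a : X → Bool) {xs : List X} {y : X} {ys : List X} → (y , ys) ∈ picks xs →
    count a xs ≡ k → a y ≡ false → count a ys ≡ k
  picks-count-same a {y = y} p∈ c eq with a y | picks-count a p∈
  picks-count-same a {y = y} p∈ c refl | false | e = ≡-trans e c

  picks-count-zero : (a : X → Bool) {xs : List X} {y : X} {ys : List X} → (y , ys) ∈ picks xs →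
    count a xs ≡ 0 → a y ≡ false
  picks-count-zero a {y = y} p∈ c with a y | picks-count a p∈
  ... | false | _ = refl
  ... | true | e with () ← ≡-trans e c

  ∑-orderings-prefixIs : ∀ k o (xs : List X) (a : X → Bool) → length xs ≡ k + o → count a xs ≡ k →
    ∑ (orderings (k + o) xs) (λ l → ⟦ prefixIs a k l ⟧) ≡ k ! * o !
  ∑-orderings-prefixIs zero o xs a e c =
    ≡-trans (∑-orderings-none o xs a e c) (sym (+-identityʳ _))
  ∑-orderings-prefixIs (suc k) o xs a e c = begin
    ∑ (orderings (suc k + o) xs) (λ l → ⟦ prefixIs a (suc k) l ⟧)
      ≡⟨ ∑-orderings (k + o) xs _ ⟩
    ∑ (picks xs) (λ (x , ys) → ∑ (orderings (k + o) ys) (λ l → ⟦ a x ∧ prefixIs a k l ⟧))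
      ≡⟨ *-identityʳ _ ⟨
    ∑ (picks xs) (λ (x , ys) → ∑ (orderings (k + o) ys) (λ l → ⟦ a x ∧ prefixIs a k l ⟧)) * 1
      ≡⟨ ∑-orderings-head (k + o) xs a (prefixIs a k) 1 (k ! * o !) (λ p∈ ax → ≡-trans (*-identityʳ _)
           (∑-orderings-prefixIs k o _ a (picks-length e p∈) (picks-count-pred a p∈ c ax))) ⟩
    count a xs * (k ! * o !)
      ≡⟨ cong (_* (k ! * o !)) c ⟩
    suc k * (k ! * o !)
      ≡⟨ *-assoc (suc k) (k !) (o !) ⟨
    suc k ! * o ! ∎
    where open ≡-Reasoning

  before-none : (a b : X → Bool) (l : List X) → none a l ≡ true → before a b l ≡ true
  before-none a b [] e = refl
  before-none a b (x ∷ l) e with b x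
  ... | true = e
  ... | false with a x
  ...   | false = before-none a b l e

  Disjointᵇ : (a b : X → Bool) → Set
  Disjointᵇ a b = ∀ x → a x ≡ true → b x ≡ false

  count-neither : (a b : X → Bool) → Disjointᵇ a b → (xs : List X) →
    count a xs + count b xs + count (neither a b) xs ≡ length xs
  count-neither a b d [] = refl
  count-neither a b d (x ∷ xs) with a x | b x | d x | count-neither a b d xs
  ... | true | true | h | e with () ← h refl
  ... | true | false | _ | e = cong suc e
  ... | false | true | _ | e = ≡-trans (cong (_+ count (neither a b) xs) (+-suc (count a xs) (count b xs))) (cong suc e)
  ... | false | false | _ | e = ≡-trans (+-suc _ _) (cong suc e)

  -- Bollobás' count: the induced order on the α + β letters of a and b is uniform.
  ∑-orderings-before : ∀ m α β o (xs : List X) (a b : X → Bool) → Disjointᵇ a b →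
    m ≡ α + β + o → length xs ≡ m → count a xs ≡ α → count b xs ≡ β →
    ∑ (orderings m xs) (λ l → ⟦ before a b l ⟧) * (α + β) ! ≡ m ! * (α ! * β !)
  ∑-orderings-before m zero β o xs a b d em e ca cb = begin
    ∑ (orderings m xs) (λ l → ⟦ before a b l ⟧) * β !
      ≡⟨ cong (_* β !) (∑-cong∈ (orderings m xs) (λ {l} l∈ →
           cong ⟦_⟧ (before-none a b l (none-count a l (≡-trans (∑-↭ _ (orderings-↭ m xs e l∈)) ca))))) ⟩
    ∑ (orderings m xs) (λ _ → 1) * β !
      ≡⟨ cong (_* β !) (∑-orderings-1 m xs e) ⟩
    m ! * β !
      ≡⟨ cong (m ! *_) (sym (*-identityˡ (β !))) ⟩
    m ! * (1 * β !) ∎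
    where open ≡-Reasoning
  ∑-orderings-before (suc m) (suc α) β o xs a b d em e ca cb = begin
    ∑ (orderings (suc m) xs) (λ l → ⟦ before a b l ⟧) * F
      ≡⟨ cong (_* F) (∑-orderings m xs _) ⟩
    ∑ (picks xs) (λ (x , ys) → ∑ (orderings m ys) (λ l → ⟦ before a b (x ∷ l) ⟧)) * F
      ≡⟨ ∑-*ʳ (picks xs) F _ ⟨
    ∑ (picks xs) (λ (x , ys) → ∑ (orderings m ys) (λ l → ⟦ before a b (x ∷ l) ⟧) * F)
      ≡⟨ ∑-cong∈ (picks xs) (λ {p} p∈ → step p∈) ⟩
    ∑ (picks xs) (λ (x , ys) → ⟦ a x ⟧ * V + ⟦ neither a b x ⟧ * W)
      ≡⟨ ∑-picks xs _ ⟩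
    ∑ xs (λ x → ⟦ a x ⟧ * V + ⟦ neither a b x ⟧ * W)
      ≡⟨ ∑-+ xs _ _ ⟩
    ∑ xs (λ x → ⟦ a x ⟧ * V) + ∑ xs (λ x → ⟦ neither a b x ⟧ * W)
      ≡⟨ cong₂ _+_ (∑-*ʳ xs V _) (∑-*ʳ xs W _) ⟩
    count a xs * V + count (neither a b) xs * W
      ≡⟨ cong₂ (λ s t → s * V + t * W) ca co ⟩
    suc α * V + o * W
      ≡⟨ collect α β o (m !) (α !) (β !) ⟩
    (suc α + β + o) * m ! * (suc α ! * β !)
      ≡⟨ cong (λ s → s * m ! * (suc α ! * β !)) em ⟨
    suc m ! * (suc α ! * β !) ∎
    where
    open ≡-Reasoning
    -- Condition on the first letter. After multiplication by `F`, a letter of `a` contributes `V`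
    -- and a letter outside both contributes `W`; a letter of `b` contributes 0, because letters of
    -- `a` are still to come.
    F V W : ℕ
    F = (suc α + β) !
    V = (suc α + β) * (m ! * (α ! * β !))
    W = m ! * (suc α ! * β !)
    collect : ∀ α β o M A B →
      suc α * ((suc α + β) * (M * (A * B))) + o * (M * ((suc α * A) * B)) ≡
      (suc α + β + o) * M * ((suc α * A) * B)
    collect = solve-∀
    co : count (neither a b) xs ≡ o
    co = +-cancelˡ-≡ (suc α + β) _ _ (begin
      suc α + β + count (neither a b) xs
        ≡⟨ cong₂ (λ s t → s + t + count (neither a b) xs) ca cb ⟨
      count a xs + count b xs + count (neither a b) xs
        ≡⟨ count-neither a b d xs ⟩
      length xs
        ≡⟨ ≡-trans e em ⟩
      suc α + β + o ∎)
    swap* : ∀ s f g → s * (f * g) ≡ f * (s * g)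
    swap* = solve-∀
    step : ∀ {x ys} → (x , ys) ∈ picks xs →
      ∑ (orderings m ys) (λ l → ⟦ before a b (x ∷ l) ⟧) * F ≡ ⟦ a x ⟧ * V + ⟦ neither a b x ⟧ * W
    step {x} {ys} p∈ with a x in ax | b x in bx
    ... | true | true with () ← ≡-trans (sym bx) (d x ax)
    ... | true | false = begin
      S * ((suc α + β) * (α + β) !)
        ≡⟨ swap* S (suc α + β) ((α + β) !) ⟩
      (suc α + β) * (S * (α + β) !)
        ≡⟨ cong ((suc α + β) *_) (∑-orderings-before m α β o ys a b d (suc-injective em)
             (picks-length e p∈) (picks-count-pred a p∈ ca ax) (picks-count-same b p∈ cb bx)) ⟩
      V
        ≡⟨ ≡-trans (+-identityʳ _) (+-identityʳ _) ⟨
      1 * V + 0 ∎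
      where
      S : ℕ
      S = ∑ (orderings m ys) (λ l → ⟦ before a b l ⟧)
    ... | false | true = cong (_* F) (∑-zero (orderings m ys) (λ {l} l∈ → noA l l∈))
      where
      noA : ∀ l → l ∈ orderings m ys → ⟦ none a l ⟧ ≡ 0
      noA l l∈ with none a l in nl
      ... | false = refl
      ... | true with () ← ≡-trans (sym (picks-count-same a p∈ ca ax))
                    (≡-trans (sym (∑-↭ _ (orderings-↭ m ys (picks-length e p∈) l∈))) (count-none a l nl))
    ... | false | false = ≡-trans (last o em co) (sym (+-identityʳ W))
      where
      -- The letter `x` lies outside both, so `o` must be a successor; it is generalised here in
      -- order to be split.
      last : ∀ o → suc m ≡ suc α + β + o → count (neither a b) xs ≡ o →
        ∑ (orderings m ys) (λ l → ⟦ before a b l ⟧) * F ≡ W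
      last zero em co with () ← ≡-trans (sym (cong₂ (λ s t → not s ∧ not t) ax bx))
                                (picks-count-zero (neither a b) p∈ co)
      last (suc o) em co = ∑-orderings-before m (suc α) β o ys a b d
        (suc-injective (≡-trans em (+-suc (suc α + β) o))) (picks-length e p∈)
        (picks-count-same a p∈ ca ax) (picks-count-same b p∈ cb bx)

  -- There are `suc α` choices for the first letter. The remaining α letters of `a` then precede the
  -- β letters of `b` in a fraction α! β! / (α + β)! of the cases.
  ∑-orderings-leads : ∀ m α β o (xs : List X) (a b : X → Bool) → Disjointᵇ a b →
    m ≡ α + β + o → length xs ≡ suc m → count a xs ≡ suc α → count b xs ≡ β →
    ∑ (orderings (suc m) xs) (λ l → ⟦ leads a b l ⟧) * (α + β) ! ≡ suc α * (m ! * (α ! * β !))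
  ∑-orderings-leads m α β o xs a b d em e ca cb = begin
    ∑ (orderings (suc m) xs) (λ l → ⟦ leads a b l ⟧) * (α + β) !
      ≡⟨ cong (_* (α + β) !) (∑-orderings m xs _) ⟩
    ∑ (picks xs) (λ (x , ys) → ∑ (orderings m ys) (λ l → ⟦ a x ∧ before a b l ⟧)) * (α + β) !
      ≡⟨ ∑-orderings-head m xs a (before a b) _ _ (λ {x} {ys} p∈ ax →
           ∑-orderings-before m α β o ys a b d em (picks-length e p∈)
             (picks-count-pred a p∈ ca ax) (picks-count-same b p∈ cb (d x ax))) ⟩
    count a xs * (m ! * (α ! * β !))
      ≡⟨ cong (_* (m ! * (α ! * β !))) ca ⟩
    suc α * (m ! * (α ! * β !)) ∎
    where open ≡-Reasoning

  ∑-orderings-leadsSecond : ∀ m α β o (xs : List X) (a b : X → Bool) → Disjointᵇ a b →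
    m ≡ α + β + o → length xs ≡ suc (suc m) → count a xs ≡ suc α → count b xs ≡ β →
    count (neither a b) xs ≡ suc o →
    ∑ (orderings (suc (suc m)) xs) (λ l → ⟦ leadsSecond a b l ⟧) * (α + β) ! ≡
    suc o * (suc α * (m ! * (α ! * β !)))
  ∑-orderings-leadsSecond m α β o xs a b d em e ca cb co = begin
    ∑ (orderings (suc (suc m)) xs) (λ l → ⟦ leadsSecond a b l ⟧) * (α + β) !
      ≡⟨ cong (_* (α + β) !) (∑-orderings (suc m) xs _) ⟩
    ∑ (picks xs) (λ (x , ys) → ∑ (orderings (suc m) ys) (λ l → ⟦ neither a b x ∧ leads a b l ⟧)) * (α + β) !
      ≡⟨ ∑-orderings-head (suc m) xs (neither a b) (leads a b) _ _ (λ {x} {ys} p∈ cx →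
           ∑-orderings-leads m α β o ys a b d em (picks-length e p∈)
             (picks-count-same a p∈ ca (neither-a x cx)) (picks-count-same b p∈ cb (neither-b x cx))) ⟩
    count (neither a b) xs * (suc α * (m ! * (α ! * β !)))
      ≡⟨ cong (_* (suc α * (m ! * (α ! * β !)))) co ⟩
    suc o * (suc α * (m ! * (α ! * β !))) ∎
    where
    open ≡-Reasoning
    neither-a : ∀ x → neither a b x ≡ true → a x ≡ false
    neither-a x _ with a x | b x
    neither-a x _ | false | _ = refl
    neither-b : ∀ x → neither a b x ≡ true → b x ≡ false
    neither-b x _ with a x | b x
    neither-b x _ | false | false = refl

  ∧-true : ∀ {a b : Bool} → a ∧ b ≡ true → a ≡ true × b ≡ true
  ∧-true {true} {true} _ = refl , refl

  true≢false : ∀ {b : Bool} → b ≡ true → b ≡ false → ⊥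
  true≢false refl ()

  -- Patterns in a word, read off by position

  none-sound : (a : X → Bool) (g : ℕ → X) (m : ℕ) → none a (applyUpTo g m) ≡ true →
    ∀ {p} → p < m → a (g p) ≡ false
  none-sound a g (suc m) e {p} p<m with a (g 0) in eq
  none-sound a g (suc m) e {zero} p<m | false = eq
  none-sound a g (suc m) e {suc p} (s≤s p<m) | false = none-sound a (g ∘ suc) m e p<m

  none-complete : (a : X → Bool) (g : ℕ → X) (m : ℕ) → (∀ {p} → p < m → a (g p) ≡ false) →
    none a (applyUpTo g m) ≡ true
  none-complete a g zero h = refl
  none-complete a g (suc m) h rewrite h z<s = none-complete a (g ∘ suc) m (h ∘ s<s)

  prefixIs-sound : (a : X → Bool) (g : ℕ → X) (k m : ℕ) → prefixIs a k (applyUpTo g m) ≡ true →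
    (∀ {p} → p < k → a (g p) ≡ true) × (∀ {p} → p < m → a (g p) ≡ true → p < k)
  prefixIs-sound a g zero m e =
    (λ ()) , (λ p<m ap → ⊥-elim (true≢false ap (none-sound a g m e p<m)))
  prefixIs-sound a g (suc k) (suc m) e with ∧-true {a (g 0)} e
  ... | a0 , rest with prefixIs-sound a (g ∘ suc) k m rest
  ...   | inside , outside = in′ , out′
    where
    in′ : ∀ {p} → p < suc k → a (g p) ≡ true
    in′ {zero} _ = a0
    in′ {suc p} (s≤s p<k) = inside p<k
    out′ : ∀ {p} → p < suc m → a (g p) ≡ true → p < suc k
    out′ {zero} _ _ = z<s
    out′ {suc p} (s≤s p<m) ap = s<s (outside p<m ap)

  before-sound : (a b : X → Bool) (g : ℕ → X) (m : ℕ) → before a b (applyUpTo g m) ≡ true →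
    ∀ {p q} → p < m → q < m → a (g p) ≡ true → b (g q) ≡ true → p < q
  before-sound a b g (suc m) e {p} {q} p<m q<m ap bq with b (g 0) in b0
  before-sound a b g (suc m) e {p} {q} p<m q<m ap bq | true =
    ⊥-elim (true≢false ap (none-sound a g (suc m) e p<m))
  before-sound a b g (suc m) e {p} {zero} p<m q<m ap bq | false = ⊥-elim (true≢false bq b0)
  before-sound a b g (suc m) e {zero} {suc q} p<m q<m ap bq | false = z<s
  before-sound a b g (suc m) e {suc p} {suc q} (s≤s p<m) (s≤s q<m) ap bq | false =
    s<s (before-sound a b (g ∘ suc) m e p<m q<m ap bq)

  before-complete : (a b : X → Bool) (g : ℕ → X) (m : ℕ) →
    (∀ {p q} → p < m → q < m → a (g p) ≡ true → b (g q) ≡ true → p < q) →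
    before a b (applyUpTo g m) ≡ true
  before-complete a b g zero h = refl
  before-complete a b g (suc m) h with b (g 0) in b0
  ... | false = before-complete a b (g ∘ suc) m
    (λ p<m q<m ap bq → ≤-pred (h (s<s p<m) (s<s q<m) ap bq))
  ... | true = none-complete a g (suc m) noA
    where
    noA : ∀ {p} → p < suc m → a (g p) ≡ false
    noA {p} p<m with a (g p) in ap
    ... | false = refl
    ... | true with () ← h p<m z<s ap b0

  leads-before : (a b : X → Bool) → Disjointᵇ a b → (l : List X) → leads a b l ≡ true → before a b l ≡ true
  leads-before a b d (x ∷ l) e with ∧-true {a x} e
  ... | ax , rest rewrite d x ax = rest

  leads-first : (a b : X → Bool) (g : ℕ → X) (m : ℕ) → leads a b (applyUpTo g m) ≡ true → a (g 0) ≡ true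
  leads-first a b g (suc m) e = proj₁ (∧-true e)

  leadsSecond-sound : (a b : X → Bool) (g : ℕ → X) (m : ℕ) → leadsSecond a b (applyUpTo g (suc m)) ≡ true →
    a (g 0) ≡ false × b (g 0) ≡ false × leads a b (applyUpTo (g ∘ suc) m) ≡ true
  leadsSecond-sound a b g m e with a (g 0) | b (g 0)
  ... | false | false = refl , refl , e

  before-leads : (a b : X → Bool) → Disjointᵇ a b → (x : X) (l : List X) → a x ≡ true →
    before a b (x ∷ l) ≡ true → leads a b (x ∷ l) ≡ true
  before-leads a b d x l ax e rewrite d x ax | ax = e

  -- Sums over an interval and over one period

  ∑-applyUpTo : (g : ℕ → ℕ) (m : ℕ) (h : ℕ → ℕ) → ∑ (applyUpTo g m) h ≡ ∑ (upTo m) (h ∘ g)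
  ∑-applyUpTo g m h = ≡-trans (cong (λ l → ∑ l h) (sym (map-upTo g m))) (∑-map g (upTo m) h)

  ∑-upTo-suc : (m : ℕ) (h : ℕ → ℕ) → ∑ (upTo (suc m)) h ≡ h 0 + ∑ (upTo m) (h ∘ suc)
  ∑-upTo-suc m h = cong (h 0 +_) (∑-applyUpTo suc m h)

  ∑-upTo-+ : (m o : ℕ) (h : ℕ → ℕ) →
    ∑ (upTo (m + o)) h ≡ ∑ (upTo m) h + ∑ (upTo o) (λ i → h (m + i))
  ∑-upTo-+ zero o h = refl
  ∑-upTo-+ (suc m) o h = begin
    ∑ (upTo (suc (m + o))) h
      ≡⟨ ∑-upTo-suc (m + o) h ⟩
    h 0 + ∑ (upTo (m + o)) (h ∘ suc)
      ≡⟨ cong (h 0 +_) (∑-upTo-+ m o (h ∘ suc)) ⟩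
    h 0 + (∑ (upTo m) (h ∘ suc) + ∑ (upTo o) (λ i → h (suc m + i)))
      ≡⟨ +-assoc (h 0) _ _ ⟨
    h 0 + ∑ (upTo m) (h ∘ suc) + ∑ (upTo o) (λ i → h (suc m + i))
      ≡⟨ cong (_+ ∑ (upTo o) (λ i → h (suc m + i))) (∑-upTo-suc m h) ⟨
    ∑ (upTo (suc m)) h + ∑ (upTo o) (λ i → h (suc m + i)) ∎
    where open ≡-Reasoning

  -- For a shift by one, both sums arise from the sum over 0, ..., n by deleting one end, and the
  -- two end terms agree by periodicity.
  ∑-upTo-shift : (n i : ℕ) (h : ℕ → ℕ) → (∀ j → h (j + n) ≡ h j) →
    ∑ (upTo n) (λ j → h (i + j)) ≡ ∑ (upTo n) h
  ∑-upTo-shift n zero h per = refl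
  ∑-upTo-shift n (suc i) h per = begin
    ∑ (upTo n) (λ j → h (suc i + j))
      ≡⟨ ∑-upTo-shift n i (h ∘ suc) (λ j → per (suc j)) ⟩
    ∑ (upTo n) (h ∘ suc)
      ≡⟨ +-cancelˡ-≡ (h 0) _ _ (≡-trans (≡-trans (sym (∑-upTo-suc n h)) last-out) (+-comm _ (h 0))) ⟩
    ∑ (upTo n) h ∎
    where
    open ≡-Reasoning
    last-out : ∑ (upTo (suc n)) h ≡ ∑ (upTo n) h + h 0
    last-out = begin
      ∑ (upTo (suc n)) h
        ≡⟨ cong (λ m → ∑ (upTo m) h) (+-comm 1 n) ⟩
      ∑ (upTo (n + 1)) h
        ≡⟨ ∑-upTo-+ n 1 h ⟩
      ∑ (upTo n) h + (h (n + 0) + 0)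
        ≡⟨ cong (∑ (upTo n) h +_) (≡-trans (+-identityʳ _) (≡-trans (cong h (+-comm n 0)) (per 0))) ⟩
      ∑ (upTo n) h + h 0 ∎

  last-true : (P : ℕ → Bool) (lo m : ℕ) → P lo ≡ true →
    ∃ λ q → lo ≤ q × q < suc m + lo × P q ≡ true × (∀ {p} → q < p → p < suc m + lo → P p ≡ false)
  last-true P lo zero e = lo , ≤-refl , ≤-refl , e , λ q<p p<lo → ⊥-elim (<-irrefl refl (<-≤-trans q<p (≤-pred p<lo)))
  last-true P lo (suc m) e with P (suc m + lo) in eq
  ... | true = suc m + lo , m≤n+m lo (suc m) , ≤-refl , eq ,
    λ q<p p<lo → ⊥-elim (<-irrefl refl (<-≤-trans q<p (≤-pred p<lo)))
  ... | false with last-true P lo m e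
  ...   | q , lo≤q , q< , Pq , after = q , lo≤q , m≤n⇒m≤1+n q< , Pq , after′
    where
    after′ : ∀ {p} → q < p → p < suc (suc m) + lo → P p ≡ false
    after′ {p} q<p p< with m≤n⇒m<n∨m≡n (≤-pred p<)
    ... | inj₁ p<′ = after q<p p<′
    ... | inj₂ refl = eq

  -- Subsets as Boolean predicates

  _∋_ : ∀ {n} → Subset n → Fin n → Set
  A ∋ x = lookup A x ≡ true

  Disj : ∀ {n} → Subset n → Subset n → Set
  Disj A B = Disjointᵇ (lookup A) (lookup B)

  Meets : ∀ {n} → Subset n → Subset n → Set
  Meets A B = ∃ λ x → A ∋ x × B ∋ x

  Disj-sym : ∀ {n} {A B : Subset n} → Disj A B → Disj B A
  Disj-sym {A = A} d x Bx with lookup A x in Ax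
  ... | false = refl
  ... | true = ⊥-elim (true≢false Bx (d x Ax))

  Disj⇒¬Meets : ∀ {n} {A B : Subset n} → Disj A B → ¬ Meets A B
  Disj⇒¬Meets d (x , Ax , Bx) = true≢false Bx (d x Ax)

  disj-or-meets : ∀ {n} (A B : Subset n) → Disj A B ⊎ Meets A B
  disj-or-meets A B with Fin.any? (λ x → (lookup A x Bool.≟ true) ×-dec (lookup B x Bool.≟ true))
  ... | yes m = inj₂ m
  ... | no ¬m = inj₁ (λ x Ax → Bool.¬-not (λ Bx → ¬m (x , Ax , Bx)))

  size⇒nonempty : ∀ {n k} {A : Subset n} → ∣ A ∣ ≡ suc k → ∃ λ x → A ∋ x
  size⇒nonempty {n = n} {A = A} e with nonempty? A
  ... | yes (x , x∈A) = x , []=⇒lookup x∈A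
  ... | no empty with () ← ≡-trans (sym e) (≡-trans (cong ∣_∣ (Empty-unique empty)) (∣⊥∣≡0 n))

  count-allFin : ∀ {n} (A : Subset n) → count (lookup A) (allFin n) ≡ ∣ A ∣
  count-allFin [] = refl
  count-allFin {n = suc n} (s ∷ A) = begin
    ⟦ s ⟧ + ∑ (tabulate suc) (λ x → ⟦ lookup (s ∷ A) x ⟧)
      ≡⟨ cong (λ l → ⟦ s ⟧ + ∑ l (λ x → ⟦ lookup (s ∷ A) x ⟧)) (map-tabulate (λ x → x) suc) ⟨
    ⟦ s ⟧ + ∑ (map suc (allFin n)) (λ x → ⟦ lookup (s ∷ A) x ⟧)
      ≡⟨ cong (⟦ s ⟧ +_) (∑-map suc (allFin n) _) ⟩
    ⟦ s ⟧ + count (lookup A) (allFin n)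
      ≡⟨ cong (⟦ s ⟧ +_) (count-allFin A) ⟩
    ⟦ s ⟧ + ∣ A ∣
      ≡⟨ head s ⟩
    ∣ s ∷ A ∣ ∎
    where
    open ≡-Reasoning
    head : ∀ s → ⟦ s ⟧ + ∣ A ∣ ≡ ∣ s ∷ A ∣
    head true = refl
    head false = refl

  three-disjoint : ∀ {n} {A B D : Subset n} → Disj A B → Disj A D → Disj B D → ∣ A ∣ + ∣ B ∣ + ∣ D ∣ ≤ n
  three-disjoint {n = n} {A} {B} {D} dAB dAD dBD = begin
    ∣ A ∣ + ∣ B ∣ + ∣ D ∣
      ≡⟨ cong₂ _+_ (cong₂ _+_ (count-allFin A) (count-allFin B)) (count-allFin D) ⟨
    count (lookup A) (allFin n) + count (lookup B) (allFin n) + count (lookup D) (allFin n)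
      ≤⟨ +-monoʳ-≤ _ (∑-mono (allFin n) (λ {x} _ → outside x)) ⟩
    count (lookup A) (allFin n) + count (lookup B) (allFin n) + count (neither (lookup A) (lookup B)) (allFin n)
      ≡⟨ count-neither (lookup A) (lookup B) dAB (allFin n) ⟩
    length (allFin n)
      ≡⟨ length-tabulate (λ x → x) ⟩
    n ∎
    where
    open ≤-Reasoning
    outside : ∀ x → ⟦ lookup D x ⟧ ≤ ⟦ neither (lookup A) (lookup B) x ⟧
    outside x with lookup D x | Disj-sym {A = A} {D} dAD x | Disj-sym {A = B} {D} dBD x
    ... | false | _ | _ = z≤n
    ... | true | a | b rewrite a refl | b refl = ≤-refl

  ∋-ext : ∀ {n} {A B : Subset n} → ∣ A ∣ ≡ ∣ B ∣ → (∀ {x} → A ∋ x → B ∋ x) → A ≡ B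
  ∋-ext {A = A} {B} e h = ⊆-antisym A⊆B B⊆A
    where
    A⊆B : A ⊆ B
    A⊆B x∈A = lookup⇒[]= _ B (h ([]=⇒lookup x∈A))
    B⊆A : B ⊆ A
    B⊆A {x} x∈B with x ∈? A
    ... | yes x∈A = x∈A
    ... | no x∉A = ⊥-elim (<-irrefl e (p⊂q⇒∣p∣<∣q∣ (A⊆B , x , x∈B , x∉A)))

  -- Mated families, cyclic orders and weights

  record MatedFamily (n k : ℕ) : Set where
    field
      sets : List (Subset n)
      unique : Unique sets
      size : ∀ {A} → A ∈ sets → ∣ A ∣ ≡ k
      nonempty : ∀ {A} → A ∈ sets → ∃ λ x → A ∋ x
      -- This is what remains of the division into families.
      transitive : ∀ {A B D} → A ∈ sets → B ∈ sets → D ∈ sets →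
        Disj A B → Disj D B → A ≢ D → Disj A D
      isolated : Subset n → Bool
      isolated-meets : ∀ {A B} → A ∈ sets → B ∈ sets → isolated A ≡ true → Meets A B
      mate : Subset n → Subset n
      mate∈ : ∀ {A} → A ∈ sets → isolated A ≡ false → mate A ∈ sets
      mate-disj : ∀ {A} → A ∈ sets → isolated A ≡ false → Disj A (mate A)

  -- The circle is unrolled along ℕ, and each window of n positions lists every element once.
  -- Positions on either side of a cut can then be compared by the order of ℕ instead of modulo n.
  record CyclicOrder (n : ℕ) : Set where
    field
      at : ℕ → Fin n
      periodic : ∀ i → at (i + n) ≡ at i
      injective : ∀ i {p q} → i ≤ p → p < q → q < i + n → at p ≢ at q
      surjective : ∀ i x → ∃ λ p → i ≤ p × p < i + n × at p ≡ x

  module Weights (n k e : ℕ) (M : MatedFamily n k) where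
    open MatedFamily M

    arcs : Subset n → List (Fin n) → Bool
    arcs A l = isolated A ∧ prefixIs (lookup A) k l

    leading : Subset n → List (Fin n) → Bool
    leading A l = not (isolated A) ∧ leads (lookup A) (lookup (mate A)) l

    leading₂ : Subset n → List (Fin n) → Bool
    leading₂ A l = not (isolated A) ∧ leadsSecond (lookup A) (lookup (mate A)) l

    weight : Subset n → List (Fin n) → ℕ
    weight A l = n * ⟦ arcs A l ⟧ + (k * ⟦ leading A l ⟧ + e * ⟦ leading₂ A l ⟧)

  -- Arcs and separated pairs

  module Cuts {n k : ℕ} (M : MatedFamily n k) (O : CyclicOrder n) where
    open MatedFamily M
    open CyclicOrder O

    cut : ℕ → List (Fin n)
    cut i = applyUpTo (λ j → at (i + j)) n

    Before : Subset n → Subset n → ℕ → Set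
    Before A B i = ∀ {p q} → i ≤ p → p < i + n → i ≤ q → q < i + n →
      A ∋ at p → B ∋ at q → p < q

    record Arc (A : Subset n) (i : ℕ) : Set where
      field
        inside : ∀ {p} → i ≤ p → p < i + k → A ∋ at p
        outside : ∀ {p} → i ≤ p → p < i + n → A ∋ at p → p < i + k

    at-∸ : ∀ {i p} → i ≤ p → at (i + (p ∸ i)) ≡ at p
    at-∸ i≤p = cong at (m+[n∸m]≡n i≤p)

    ∸-bound : ∀ {i p} m → i ≤ p → p < i + m → p ∸ i < m
    ∸-bound {i} {p} m i≤p p< = +-cancelˡ-< i (p ∸ i) m (subst (_< i + m) (sym (m+[n∸m]≡n i≤p)) p<)

    prefixIs⇒Arc : ∀ {A} i → prefixIs (lookup A) k (cut i) ≡ true → Arc A i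
    prefixIs⇒Arc {A} i e with prefixIs-sound (lookup A) (λ j → at (i + j)) k n e
    ... | ins , out = record
      { inside = λ i≤p p< → subst (A ∋_) (at-∸ i≤p) (ins (∸-bound k i≤p p<))
      ; outside = λ {p} i≤p p< Ap → subst (_< i + k) (m+[n∸m]≡n i≤p)
          (+-monoʳ-< i (out (∸-bound n i≤p p<) (subst (A ∋_) (sym (at-∸ i≤p)) Ap))) }

    before⇒Before : ∀ {A B} i → before (lookup A) (lookup B) (cut i) ≡ true → Before A B i
    before⇒Before {A} {B} i e {p} {q} i≤p p< i≤q q< Ap Bq =
      subst₂ _<_ (m+[n∸m]≡n i≤p) (m+[n∸m]≡n i≤q) (+-monoʳ-< i
        (before-sound (lookup A) (lookup B) (λ j → at (i + j)) n e (∸-bound n i≤p p<) (∸-bound n i≤q q<)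
          (subst (A ∋_) (sym (at-∸ i≤p)) Ap) (subst (B ∋_) (sym (at-∸ i≤q)) Bq)))

    Before⇒before : ∀ {A B} i → Before A B i → before (lookup A) (lookup B) (cut i) ≡ true
    Before⇒before {A} {B} i h = before-complete (lookup A) (lookup B) (λ j → at (i + j)) n
      (λ {p} {q} p<n q<n Ap Bq → +-cancelˡ-< i p q
        (h (m≤m+n i p) (+-monoʳ-< i p<n) (m≤m+n i q) (+-monoʳ-< i q<n) Ap Bq))

    arc-position : ∀ {A i x} → Arc A i → A ∋ x → ∃ λ p → i ≤ p × p < i + k × at p ≡ x
    arc-position {A} {i} {x} arc Ax with surjective i x
    ... | p , i≤p , p< , refl = p , i≤p , Arc.outside arc i≤p p< Ax , refl

    arc-unique : ∀ {A B i} → A ∈ sets → B ∈ sets → Arc A i → Arc B i → A ≡ B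
    arc-unique {A} {B} A∈ B∈ a b = ∋-ext (≡-trans (size A∈) (sym (size B∈))) sub
      where
      sub : ∀ {x} → A ∋ x → B ∋ x
      sub Ax with arc-position a Ax
      ... | p , i≤p , p< , refl = Arc.inside b i≤p p<

    arcs-overlap : ∀ {A B i j} → A ∈ sets → B ∈ sets → isolated A ≡ true → Arc A i → Arc B j →
      i + k ≤ j → j + k ≤ i + n → ⊥
    arcs-overlap {A} {B} {i} {j} A∈ B∈ iso a b i+k≤j j+k≤i+n with isolated-meets A∈ B∈ iso
    ... | x , Ax , Bx with arc-position a Ax | arc-position b Bx
    ...   | p , i≤p , p< , refl | q , j≤q , q< , eq =
      injective i i≤p (<-≤-trans p< (≤-trans i+k≤j j≤q)) (<-≤-trans q< j+k≤i+n) (sym eq)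

    -- An arc at either end of the line that meets both parts of a separated
    -- pair would swallow one of them whole.
    prefix-arc-¬separated : ∀ {G A B i} → k ≤ n → G ∈ sets → A ∈ sets → B ∈ sets → isolated G ≡ true →
      Arc G i → Disj A B → Before A B i → ⊥
    prefix-arc-¬separated {G} {A} {B} {i} k≤n G∈ A∈ B∈ iso g d h with isolated-meets G∈ B∈ iso
    ... | x , Gx , Bx with arc-position g Gx
    ...   | q , i≤q , q< , refl = Disj⇒¬Meets {A = A} {B} d (_ , subst (_∋ at q) (sym A≡G) Gx , Bx)
      where
      A⊆G : ∀ {z} → A ∋ z → G ∋ z
      A⊆G {z} Az with surjective i z
      ... | p , i≤p , p< , refl = Arc.inside g i≤p
        (<-trans (h i≤p p< i≤q (<-≤-trans q< (+-monoʳ-≤ i k≤n)) Az Bx) q<)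
      A≡G : A ≡ G
      A≡G = ∋-ext (≡-trans (size A∈) (sym (size G∈))) A⊆G

    suffix-arc-¬separated : ∀ {G A B i j} → i ≤ j → j + k ≡ i + n → G ∈ sets → A ∈ sets → B ∈ sets →
      isolated G ≡ true → Arc G j → Disj A B → Before A B i → ⊥
    suffix-arc-¬separated {G} {A} {B} {i} {j} i≤j j+k≡i+n G∈ A∈ B∈ iso g d h with isolated-meets G∈ A∈ iso
    ... | x , Gx , Ax with arc-position g Gx
    ...   | p , j≤p , p< , refl = Disj⇒¬Meets {A = A} {B} d (_ , Ax , subst (_∋ at p) (sym B≡G) Gx)
      where
      B⊆G : ∀ {z} → B ∋ z → G ∋ z
      B⊆G {z} Bz with surjective i z
      ... | q , i≤q , q< , refl = Arc.inside g
        (≤-trans j≤p (<⇒≤ (h (≤-trans i≤j j≤p) (subst (p <_) j+k≡i+n p<) i≤q q< Ax Bz)))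
        (subst (q <_) (sym j+k≡i+n) q<)
      B≡G : B ≡ G
      B≡G = ∋-ext (≡-trans (size B∈) (sym (size G∈))) B⊆G

    -- If `A′` missed `B`, then `A` and `A′` would both be disjoint from `B`, hence from each other
    -- by `transitive`, although they meet. The same argument applies to `A` and `B′`.
    cross-meets : ∀ {A B A′ B′} → A ∈ sets → B ∈ sets → A′ ∈ sets → B′ ∈ sets →
      Disj A B → Disj A′ B′ → Meets A A′ → A ≢ A′ → Meets A′ B × Meets A B′
    cross-meets {A} {B} {A′} {B′} A∈ B∈ A′∈ B′∈ d d′ meets A≢A′ with disj-or-meets A′ B | disj-or-meets A B′
    ... | inj₁ dd | _ = ⊥-elim (Disj⇒¬Meets {A = A} {A′} (transitive A∈ B∈ A′∈ d dd A≢A′) meets)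
    ... | inj₂ _ | inj₁ dd = ⊥-elim (Disj⇒¬Meets {A = A} {A′} (transitive A∈ B′∈ A′∈ dd d′ A≢A′) meets)
    ... | inj₂ m | inj₂ m′ = m , m′

    -- Otherwise there are points in A′ ∩ B and in A ∩ B′, and the two orders force each of them to
    -- precede the other.
    separated-unique : ∀ {A B A′ B′ i} → A ∈ sets → B ∈ sets → A′ ∈ sets → B′ ∈ sets →
      Disj A B → Disj A′ B′ → Meets A A′ → Before A B i → Before A′ B′ i → A ≡ A′
    separated-unique {A} {B} {A′} {B′} {i} A∈ B∈ A′∈ B′∈ d d′ meets h h′ with ≡-dec Bool._≟_ A A′
    ... | yes eq = eq
    ... | no A≢A′ with cross-meets A∈ B∈ A′∈ B′∈ d d′ meets A≢A′
    ...   | (x , A′x , Bx) , (y , Ay , B′y) with surjective i x | surjective i y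
    ...     | p , i≤p , p< , refl | q , i≤q , q< , refl =
      ⊥-elim (<-asym (h i≤q q< i≤p p< Ay Bx) (h′ i≤p p< i≤q q< A′x B′y))

    record Leads (A : Subset n) (i : ℕ) : Set where
      field
        first : A ∋ at i
        order : Before A (mate A) i

    -- Read from `i`, every element of the mate comes after `j`, hence between `j` and `i + n`. Read
    -- from `j`, position `i + n` repeats the element of `A` at `i` and would have to precede them
    -- all.
    leads-unique : ∀ {A i j} → A ∈ sets → isolated A ≡ false → Leads A i → Leads A j →
      i < j → j < i + n → ⊥
    leads-unique {A} {i} {j} A∈ ni li lj i<j j< with nonempty (mate∈ A∈ ni)
    ... | x , Bx with surjective i x
    ...   | q , i≤q , q< , refl = <-asym q< (Leads.order lj
        (<⇒≤ j<) (+-monoˡ-< n i<j) (<⇒≤ j<q) (<-trans q< (+-monoˡ-< n i<j))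
        (subst (A ∋_) (sym (periodic i)) (Leads.first li)) Bx)
      where
      j<q : j < q
      j<q = Leads.order li (<⇒≤ i<j) j< i≤q q< (Leads.first lj) Bx

  applyUpTo-cong : ∀ {X : Set} {g h : ℕ → X} (m : ℕ) → (∀ j → j < m → g j ≡ h j) → applyUpTo g m ≡ applyUpTo h m
  applyUpTo-cong zero eq = refl
  applyUpTo-cong (suc m) eq = cong₂ _∷_ (eq 0 z<s) (applyUpTo-cong m (λ j j<m → eq (suc j) (s<s j<m)))

  shift : ∀ {n} → ℕ → CyclicOrder n → CyclicOrder n
  shift {n} s O = record
    { at = λ i → at (s + i)
    ; periodic = λ i → ≡-trans (cong at (sym (+-assoc s i n))) (periodic (s + i))
    ; injective = λ i {p} {q} i≤p p<q q< → injective (s + i) (+-monoʳ-≤ s i≤p) (+-monoʳ-< s p<q)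
        (subst (s + q <_) (sym (+-assoc s i n)) (+-monoʳ-< s q<))
    ; surjective = sur }
    where
    open CyclicOrder O
    sur : ∀ i x → ∃ λ p → i ≤ p × p < i + n × at (s + p) ≡ x
    sur i x with surjective (s + i) x
    ... | p , s+i≤p , p< , eq = p ∸ s ,
      m+n≤o⇒m≤o∸n i (subst (_≤ p) (+-comm s i) s+i≤p) ,
      +-cancelˡ-< s _ _ (subst₂ _<_ (sym p-eq) (+-assoc s i n) p<) ,
      ≡-trans (cong at p-eq) eq
      where
      p-eq : s + (p ∸ s) ≡ p
      p-eq = m+[n∸m]≡n (m+n≤o⇒m≤o s s+i≤p)

  -- Here n = suc n′, k = suc k′, and r = n - 2k + 1 is the number of arcs disjoint from a given arc.
  module CycleBound (n′ k′ r e : ℕ) (n-split : suc n′ ≡ suc k′ + (r + k′)) (0<r : 0 < r)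
    (2[k+e]≤n : 2 * (suc k′ + e) ≤ suc n′) (e≤k : e ≤ suc k′) (e-free : e ≡ 0 ⊎ suc n′ < 3 * suc k′)
    (M : MatedFamily (suc n′) (suc k′)) where
    open MatedFamily M
    open Weights (suc n′) (suc k′) e M

    private
      n k : ℕ
      n = suc n′
      k = suc k′

      k≤n : k ≤ n
      k≤n = subst (k ≤_) (sym n-split) (m≤m+n k _)

    module At (O : CyclicOrder n) where
      open CyclicOrder O
      open Cuts M O

      -- The mirror image of `leading`: read backwards from cut `j`, the set `A` starts at once and
      -- comes entirely before its mate. Position `j + n′` is the last of the line, just before the
      -- cut when the circle is closed up.
      leadingEnd : Subset n → ℕ → Bool
      leadingEnd A j = not (isolated A) ∧ (lookup A (at (j + n′)) ∧ before (lookup (mate A)) (lookup A) (cut j))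

      ¬isolated : ∀ {A : Subset n} {b} → not (isolated A) ∧ b ≡ true → isolated A ≡ false × b ≡ true
      ¬isolated {A} eq with isolated A
      ... | false = refl , eq

      arcs⇒Arc : ∀ {A i} → arcs A (cut i) ≡ true → isolated A ≡ true × Arc A i
      arcs⇒Arc {A} {i} eq with ∧-true {isolated A} eq
      ... | iso , pre = iso , prefixIs⇒Arc i pre

      leading⇒Leads : ∀ {A i} → A ∈ sets → leading A (cut i) ≡ true → isolated A ≡ false × Leads A i
      leading⇒Leads {A} {i} A∈ eq with ¬isolated {A} eq
      ... | ni , ld = ni , record
        { first = subst (λ j → A ∋ at j) (+-identityʳ i) (leads-first (lookup A) (lookup (mate A)) (λ j → at (i + j)) n ld)
        ; order = before⇒Before {A} {mate A} i (leads-before (lookup A) (lookup (mate A)) (mate-disj A∈ ni) (cut i) ld) }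

      Leads⇒leading : ∀ {A i} → A ∈ sets → isolated A ≡ false → Leads A i → leading A (cut i) ≡ true
      Leads⇒leading {A} {i} A∈ ni l rewrite ni = before-leads (lookup A) (lookup (mate A)) (mate-disj A∈ ni) (at (i + 0)) (applyUpTo (λ j → at (i + suc j)) n′)
        (subst (λ j → A ∋ at j) (sym (+-identityʳ i)) (Leads.first l)) (Before⇒before {A} {mate A} i (Leads.order l))

      -- The lines from `i` and from `suc i` differ only in that the element at `i` moves to the
      -- end, as position `i + n`. It belongs to neither set, so both lines separate the pair.
      leading₂⇒Leads : ∀ {A i} → A ∈ sets → leading₂ A (cut i) ≡ true →
        isolated A ≡ false × ¬ (A ∋ at i) × Leads A (suc i) × Before A (mate A) i
      leading₂⇒Leads {A} {i} A∈ eq with ¬isolated {A} eq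
      ... | ni , l₂ with leadsSecond-sound (lookup A) (lookup (mate A)) (λ j → at (i + j)) n′ l₂
      ...   | a0 , b0 , ld = ni , ¬Ai , record { first = A1 ; order = order₁ } , order₀
        where
        B : Subset n
        B = mate A
        ¬Ai : ¬ (A ∋ at i)
        ¬Ai Ai = true≢false Ai (subst (λ j → lookup A (at j) ≡ false) (+-identityʳ i) a0)
        ¬Bi : ¬ (B ∋ at i)
        ¬Bi Bi = true≢false Bi (subst (λ j → lookup B (at j) ≡ false) (+-identityʳ i) b0)
        A1 : A ∋ at (suc i)
        A1 = subst (λ j → A ∋ at j) (+-comm i 1)
          (leads-first (lookup A) (lookup B) (λ j → at (i + suc j)) n′ ld)
        order₀ : Before A B i
        order₀ {p} {q} i≤p p< i≤q q< Ap Bq with m≤n⇒m<n∨m≡n i≤p | m≤n⇒m<n∨m≡n i≤q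
        ... | inj₂ refl | _ = ⊥-elim (¬Ai Ap)
        ... | inj₁ _ | inj₂ refl = ⊥-elim (¬Bi Bq)
        ... | inj₁ i<p | inj₁ i<q = subst₂ _<_ (back i<p) (back i<q) (+-monoʳ-< (suc i)
          (before-sound (lookup A) (lookup B) (λ j → at (i + suc j)) n′
            (leads-before (lookup A) (lookup B) (mate-disj A∈ ni) (applyUpTo (λ j → at (i + suc j)) n′) ld)
            (bound i<p p<) (bound i<q q<)
            (subst (λ j → A ∋ at j) (sym (≡-trans (+-suc i _) (back i<p))) Ap)
            (subst (λ j → B ∋ at j) (sym (≡-trans (+-suc i _) (back i<q))) Bq)))
          where
          back : ∀ {p} → i < p → suc i + (p ∸ suc i) ≡ p
          back = m+[n∸m]≡n
          bound : ∀ {p} → i < p → p < i + n → p ∸ suc i < n′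
          bound {p} i<p p< = ∸-bound {suc i} n′ i<p (subst (p <_) (+-suc i n′) p<)
        order₁ : Before A B (suc i)
        order₁ {p} {q} i<p p< i<q q< Ap Bq with m≤n⇒m<n∨m≡n (≤-pred p<) | m≤n⇒m<n∨m≡n (≤-pred q<)
        ... | inj₂ refl | _ = ⊥-elim (¬Ai (subst (A ∋_) (periodic i) Ap))
        ... | inj₁ _ | inj₂ refl = ⊥-elim (¬Bi (subst (B ∋_) (periodic i) Bq))
        ... | inj₁ p<′ | inj₁ q<′ = order₀ (<⇒≤ i<p) p<′ (<⇒≤ i<q) q<′ Ap Bq

      leadingEnd⇒Before : ∀ {A j} → leadingEnd A j ≡ true →
        isolated A ≡ false × A ∋ at (j + n′) × Before (mate A) A j
      leadingEnd⇒Before {A} {j} eq with ¬isolated {A} eq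
      ... | ni , rest with ∧-true {lookup A (at (j + n′))} rest
      ...   | lastA , bf = ni , lastA , before⇒Before {mate A} {A} j bf

      leading-unique : ∀ {A A′} i → A ∈ sets → A′ ∈ sets →
        leading A (cut i) ≡ true → leading A′ (cut i) ≡ true → A ≡ A′
      leading-unique i A∈ A′∈ l l′ with leading⇒Leads A∈ l | leading⇒Leads A′∈ l′
      ... | ni , L | ni′ , L′ = separated-unique {i = i} A∈ (mate∈ A∈ ni) A′∈ (mate∈ A′∈ ni′)
        (mate-disj A∈ ni) (mate-disj A′∈ ni′) (at i , Leads.first L , Leads.first L′)
        (Leads.order L) (Leads.order L′)

      leading₂-unique : ∀ {A A′} i → A ∈ sets → A′ ∈ sets →
        leading₂ A (cut i) ≡ true → leading₂ A′ (cut i) ≡ true → A ≡ A′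
      leading₂-unique i A∈ A′∈ l l′ with leading₂⇒Leads A∈ l | leading₂⇒Leads A′∈ l′
      ... | ni , _ , L , _ | ni′ , _ , L′ , _ = separated-unique {i = suc i} A∈ (mate∈ A∈ ni) A′∈ (mate∈ A′∈ ni′)
        (mate-disj A∈ ni) (mate-disj A′∈ ni′) (at (suc i) , Leads.first L , Leads.first L′)
        (Leads.order L) (Leads.order L′)

      -- The contradiction of `separated-unique` with both orders reversed; the common element is
      -- now the one at the end of the line.
      leadingEnd-unique : ∀ {A A′} j → A ∈ sets → A′ ∈ sets →
        leadingEnd A j ≡ true → leadingEnd A′ j ≡ true → A ≡ A′
      leadingEnd-unique {A} {A′} j A∈ A′∈ l l′ with leadingEnd⇒Before {A} {j} l | leadingEnd⇒Before {A′} {j} l′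
      ... | ni , x , h | ni′ , x′ , h′ with ≡-dec Bool._≟_ A A′
      ...   | yes eq = eq
      ...   | no A≢A′ with cross-meets A∈ (mate∈ A∈ ni) A′∈ (mate∈ A′∈ ni′) (mate-disj A∈ ni) (mate-disj A′∈ ni′)
                             (at (j + n′) , x , x′) A≢A′
      ...     | (y , A′y , By) , (z , Az , B′z) with surjective j y | surjective j z
      ...       | p , j≤p , p< , refl | q , j≤q , q< , refl =
        ⊥-elim (<-asym (h j≤p p< j≤q q< By Az) (h′ j≤q q< j≤p p< B′z A′y))

      -- If `A` and `A′` meet, they coincide by `separated-unique`, but only `A` contains the
      -- element at `i`. If they are disjoint, n < 3k leaves no room for a third pairwise disjoint
      -- member, so each is the mate of the other; then `A′` must precede `A`, which occupies the
      -- first position.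
      leading-leading₂ : ∀ {A A′} i → n < 3 * k → A ∈ sets → A′ ∈ sets →
        leading A (cut i) ≡ true → leading₂ A′ (cut i) ≡ true → ⊥
      leading-leading₂ {A} {A′} i n<3k A∈ A′∈ l l₂ with leading⇒Leads A∈ l | leading₂⇒Leads A′∈ l₂
      ... | ni , L | ni′ , ¬A′i , L′ , h′ = split (disj-or-meets A A′)
        where
        B B′ : Subset n
        B = mate A
        B′ = mate A′
        dAB : Disj A B
        dAB = mate-disj A∈ ni
        dA′B′ : Disj A′ B′
        dA′B′ = mate-disj A′∈ ni′
        too-big : ∀ {D E G} → D ∈ sets → E ∈ sets → G ∈ sets → Disj D E → Disj D G → Disj E G → ⊥
        too-big {D} {E} {G} D∈ E∈ G∈ d₁ d₂ d₃ = <-irrefl refl (<-≤-trans n<3k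
          (≤-trans (≤-reflexive sizes) (three-disjoint {A = D} {E} {G} d₁ d₂ d₃)))
          where
          3* : ∀ k → 3 * k ≡ k + k + k
          3* = solve-∀
          sizes : 3 * k ≡ ∣ D ∣ + ∣ E ∣ + ∣ G ∣
          sizes rewrite size D∈ | size E∈ | size G∈ = 3* k
        split : Disj A A′ ⊎ Meets A A′ → ⊥
        split (inj₂ m) = ¬A′i (subst (_∋ at i)
          (separated-unique {i = i} A∈ (mate∈ A∈ ni) A′∈ (mate∈ A′∈ ni′) dAB dA′B′ m (Leads.order L) h′)
          (Leads.first L))
        split (inj₁ d) with ≡-dec Bool._≟_ B A′ | ≡-dec Bool._≟_ A B′
        ... | no B≢A′ | _ = too-big A∈ (mate∈ A∈ ni) A′∈ dAB d
          (transitive (mate∈ A∈ ni) A∈ A′∈ (Disj-sym {A = A} {B} dAB) (Disj-sym {A = A} {A′} d) B≢A′)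
        ... | yes _ | no A≢B′ = too-big A∈ A′∈ (mate∈ A′∈ ni′) d
          (transitive A∈ A′∈ (mate∈ A′∈ ni′) d (Disj-sym {A = A′} {B′} dA′B′) A≢B′) dA′B′
        ... | yes B≡A′ | yes A≡B′ with nonempty A′∈
        ...   | x , A′x with surjective i x
        ...     | p , i≤p , p< , refl = <-irrefl refl (<-≤-trans
          (h′ i≤p p< ≤-refl (m<m+n i z<s) A′x (subst (_∋ at i) A≡B′ (Leads.first L))) i≤p)

      -- The number r + k′ is n - k, so the arc starting at `j + (r + k′)` is the one that ends at
      -- cut `j`.
      wrap : ∀ j → j + (r + k′) + k ≡ j + n
      wrap j = ≡-trans (+-assoc j (r + k′) k) (cong (j +_) (≡-trans (+-comm (r + k′) k) (sym n-split)))

      isolated-free : ∀ {G A B} j → G ∈ sets → A ∈ sets → B ∈ sets → Disj A B → Before A B j →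
        isolated G ≡ true → Arc G j ⊎ Arc G (j + (r + k′)) → ⊥
      isolated-free j G∈ A∈ B∈ d h iso (inj₁ g) = prefix-arc-¬separated k≤n G∈ A∈ B∈ iso g d h
      isolated-free j G∈ A∈ B∈ d h iso (inj₂ g) =
        suffix-arc-¬separated {i = j} (m≤m+n j _) (wrap j) G∈ A∈ B∈ iso g d h

      -- Both parts of a separated pair meet the arc F, so one of the two gaps between them lies inside F.
      gap-inside : ∀ {F A i} → F ∈ sets → isolated F ≡ true → Arc F 0 → A ∈ sets → isolated A ≡ false →
        Leads A i → i < n →
        ∃ λ t → t < k′ × (leading A (cut (suc t)) ≡ true ⊎ leadingEnd A (suc t) ≡ true)
      gap-inside {i = zero} F∈ isoF f A∈ ni L i<n =
        ⊥-elim (prefix-arc-¬separated k≤n F∈ A∈ (mate∈ A∈ ni) isoF f (mate-disj A∈ ni) (Leads.order L))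
      gap-inside {F} {A} {suc t} F∈ isoF f A∈ ni L i<n with t <? k′
      ... | yes t<k′ = t , t<k′ , inj₁ (Leads⇒leading A∈ ni L)
      -- Now the cut before `A` is not inside F, and in the line from `i` the arc F occupies the
      -- positions n, ..., n + k - 1. The last position `q` of `A` is at least n because `A` meets
      -- F, and it is not the last position of F because `B` meets F after `q`. The cut right after
      -- `q`, one turn back, is `suc s`.
      ... | no t≮k′ = s , s<k′ , inj₂ end
        where
        B : Subset n
        B = mate A
        i : ℕ
        i = suc t
        k≤i : k ≤ i
        k≤i = s≤s (≮⇒≥ t≮k′)
        lt = last-true (λ p → lookup A (at p)) i n′ (Leads.first L)
        q : ℕ
        q = proj₁ lt
        i≤q : i ≤ q
        i≤q = proj₁ (proj₂ lt)
        q<n+i : q < n + i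
        q<n+i = proj₁ (proj₂ (proj₂ lt))
        Aq : A ∋ at q
        Aq = proj₁ (proj₂ (proj₂ (proj₂ lt)))
        after : ∀ {p} → q < p → p < n + i → lookup A (at p) ≡ false
        after = proj₂ (proj₂ (proj₂ (proj₂ lt)))
        n+i≡i+n : n + i ≡ i + n
        n+i≡i+n = +-comm n i
        wrap< : ∀ {p} → p < i → p + n < n + i
        wrap< {p} p<i = subst (p + n <_) (sym n+i≡i+n) (+-monoˡ-< n p<i)
        n≤q : n ≤ q
        n≤q with isolated-meets F∈ A∈ isoF
        ... | x , Fx , Ax with arc-position f Fx
        ...   | p , _ , p<k , refl with n ≤? q
        ...     | yes h = h
        ...     | no h = ⊥-elim (true≢false (subst (A ∋_) (sym (periodic p)) Ax)
          (after (<-≤-trans (≰⇒> h) (m≤n+m n p)) (wrap< (<-≤-trans p<k k≤i))))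
        s : ℕ
        s = q ∸ n
        s+n≡q : s + n ≡ q
        s+n≡q = m∸n+n≡m n≤q
        s<k′ : s < k′
        s<k′ with isolated-meets F∈ (mate∈ A∈ ni) isoF
        ... | x , Fx , Bx with arc-position f Fx
        ...   | p , _ , p<k , refl = <-≤-trans
          (+-cancelʳ-< n s p (subst (_< p + n) (sym s+n≡q) q<p+n)) (≤-pred p<k)
          where
          q<p+n : q < p + n
          q<p+n = Leads.order L i≤q (subst (q <_) n+i≡i+n q<n+i)
            (≤-trans (<⇒≤ i<n) (m≤n+m n p))
            (subst (p + n <_) n+i≡i+n (wrap< (<-≤-trans p<k k≤i))) Aq
            (subst (B ∋_) (sym (periodic p)) Bx)
        end-position : suc s + n′ ≡ q
        end-position = ≡-trans (sym (+-suc s n′)) s+n≡q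
        end-order : Before B A (suc s)
        -- Position `i` separates the line ending at `q`: an element of `B` from `i` on would lie
        -- before `q` in the line from `i`, and an element of `A` before `i` would reappear after
        -- `q` one turn later.
        end-order {p} {p′} s<p p< s<p′ p′< Bp Ap′ = <-≤-trans p<i i≤p′
          where
          p≤q : p ≤ q
          p≤q = ≤-pred (subst (λ z → p < suc z) s+n≡q p<)
          p<i : p < i
          p<i with p <? i
          ... | yes h = h
          ... | no h = ⊥-elim (<-irrefl refl (<-≤-trans
            (Leads.order L i≤q (subst (q <_) n+i≡i+n q<n+i) (≮⇒≥ h)
              (subst (p <_) n+i≡i+n (≤-<-trans p≤q q<n+i)) Aq Bp) p≤q))
          i≤p′ : i ≤ p′
          i≤p′ with p′ <? i
          ... | no h = ≮⇒≥ h
          ... | yes h = ⊥-elim (true≢false (subst (A ∋_) (sym (periodic p′)) Ap′)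
            (after (subst (_< p′ + n) s+n≡q (+-monoˡ-< n s<p′)) (wrap< h)))
        end : leadingEnd A (suc s) ≡ true
        end rewrite ni | subst (λ z → A ∋ at z) (sym end-position) Aq = Before⇒before {B} {A} (suc s) end-order

      cut-periodic : ∀ i → cut (i + n) ≡ cut i
      cut-periodic i = applyUpTo-cong n (λ j _ → ≡-trans (cong at (reorder i n j)) (periodic (i + j)))
        where
        reorder : ∀ i n j → i + n + j ≡ i + j + n
        reorder = solve-∀

      leads-once : ∀ {A} → A ∈ sets → ∑ (upTo n) (λ i → ⟦ leading A (cut i) ⟧) ≤ 1
      leads-once {A} A∈ = ∑-⟦⟧≤1 (upTo n) (upTo⁺ n) _ same
        where
        same : ∀ {i j} → i ∈ upTo n → j ∈ upTo n →
          leading A (cut i) ≡ true → leading A (cut j) ≡ true → i ≡ j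
        same {i} {j} i∈ j∈ li lj with leading⇒Leads A∈ li | leading⇒Leads A∈ lj | <-cmp i j
        ... | _ | _ | tri≈ _ eq _ = eq
        ... | ni , L | _ , L′ | tri< i<j _ _ =
          ⊥-elim (leads-unique A∈ ni L L′ i<j (<-≤-trans (∈-upTo⁻ j∈) (m≤n+m n i)))
        ... | ni , L | _ , L′ | tri> _ _ j<i =
          ⊥-elim (leads-unique A∈ ni L′ L j<i (<-≤-trans (∈-upTo⁻ i∈) (m≤n+m n j)))

      ⟦⟧-mono : ∀ {a b : Bool} → (a ≡ true → b ≡ true) → ⟦ a ⟧ ≤ ⟦ b ⟧
      ⟦⟧-mono {false} h = z≤n
      ⟦⟧-mono {true} h rewrite h refl = ≤-refl

      leading₂-sum : ∀ {A} → A ∈ sets →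
        ∑ (upTo n) (λ i → ⟦ leading₂ A (cut i) ⟧) ≤ ∑ (upTo n) (λ i → ⟦ leading A (cut i) ⟧)
      leading₂-sum {A} A∈ = ≤-trans
        (∑-mono (upTo n) (λ {i} _ → ⟦⟧-mono (step i)))
        (≤-reflexive (∑-upTo-shift n 1 (λ i → ⟦ leading A (cut i) ⟧) (λ i → cong (⟦_⟧ ∘ leading A) (cut-periodic i))))
        where
        step : ∀ i → leading₂ A (cut i) ≡ true → leading A (cut (suc i)) ≡ true
        step i l₂ with leading₂⇒Leads A∈ l₂
        ... | ni , _ , L , _ = Leads⇒leading A∈ ni L

      -- The weight carried by one cut

      arc-count leading-count leading₂-count leadingEnd-count : ℕ → ℕ
      arc-count i = ∑ sets (λ A → ⟦ arcs A (cut i) ⟧)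
      leading-count i = ∑ sets (λ A → ⟦ leading A (cut i) ⟧)
      leading₂-count i = ∑ sets (λ A → ⟦ leading₂ A (cut i) ⟧)
      leadingEnd-count i = ∑ sets (λ A → ⟦ leadingEnd A i ⟧)

      total : ℕ → ℕ
      total i = ∑ sets (λ A → weight A (cut i))

      total-split : ∀ i → total i ≡ n * arc-count i + (k * leading-count i + e * leading₂-count i)
      total-split i = begin
        total i
          ≡⟨ ∑-+ sets (λ A → n * ⟦ arcs A (cut i) ⟧) _ ⟩
        ∑ sets (λ A → n * ⟦ arcs A (cut i) ⟧) + ∑ sets (λ A → k * ⟦ leading A (cut i) ⟧ + e * ⟦ leading₂ A (cut i) ⟧)
          ≡⟨ cong₂ _+_ (∑-*ˡ sets n _) (≡-trans (∑-+ sets (λ A → k * ⟦ leading A (cut i) ⟧) _)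
               (cong₂ _+_ (∑-*ˡ sets k _) (∑-*ˡ sets e _))) ⟩
        n * arc-count i + (k * leading-count i + e * leading₂-count i) ∎
        where open ≡-Reasoning

      leading-count≤1 : ∀ i → leading-count i ≤ 1
      leading-count≤1 i = ∑-⟦⟧≤1 sets unique _ (leading-unique i)

      leading₂-count≤1 : ∀ i → leading₂-count i ≤ 1
      leading₂-count≤1 i = ∑-⟦⟧≤1 sets unique _ (leading₂-unique i)

      leadingEnd-count≤1 : ∀ i → leadingEnd-count i ≤ 1
      leadingEnd-count≤1 i = ∑-⟦⟧≤1 sets unique _ (leadingEnd-unique i)

      arc-count≤1 : ∀ i → arc-count i ≤ 1
      arc-count≤1 i = ∑-⟦⟧≤1 sets unique _ (λ {A} {B} A∈ B∈ a b →
        arc-unique {i = i} A∈ B∈ (proj₂ (arcs⇒Arc {A} {i} a)) (proj₂ (arcs⇒Arc {B} {i} b)))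

      -- Each of the two counts is at most 1. For e = 0 only the first matters; for n < 3k,
      -- `leading-leading₂` keeps them from being positive together, so the cut carries at most k or
      -- at most e ≤ k.
      total≤k : ∀ i → arc-count i ≡ 0 → total i ≤ k
      total≤k i no-arc = begin
        total i
          ≡⟨ total-split i ⟩
        n * arc-count i + (k * leading-count i + e * leading₂-count i)
          ≡⟨ cong (λ a → n * a + (k * leading-count i + e * leading₂-count i)) no-arc ⟩
        n * 0 + (k * leading-count i + e * leading₂-count i)
          ≡⟨ cong (_+ (k * leading-count i + e * leading₂-count i)) (*-zeroʳ n) ⟩
        k * leading-count i + e * leading₂-count i
          ≤⟨ bound e-free ⟩
        k ∎
        where
        open ≤-Reasoning
        times≤ : ∀ c {x} → x ≤ 1 → c * x ≤ c
        times≤ c {x} x≤1 = ≤-trans (*-monoʳ-≤ c x≤1) (≤-reflexive (*-identityʳ c))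
        bound : e ≡ 0 ⊎ n < 3 * k → k * leading-count i + e * leading₂-count i ≤ k
        bound (inj₁ e≡0) = begin
          k * leading-count i + e * leading₂-count i
            ≡⟨ cong (λ z → k * leading-count i + z * leading₂-count i) e≡0 ⟩
          k * leading-count i + 0
            ≡⟨ +-identityʳ _ ⟩
          k * leading-count i
            ≤⟨ times≤ k (leading-count≤1 i) ⟩
          k ∎
        bound (inj₂ n<3k) with ∑-⟦⟧-positive sets (λ A → leading A (cut i)) | ∑-⟦⟧-positive sets (λ A → leading₂ A (cut i))
        ... | inj₁ z | _ = begin
          k * leading-count i + e * leading₂-count i
            ≡⟨ cong (λ c → k * c + e * leading₂-count i) z ⟩
          k * 0 + e * leading₂-count i
            ≡⟨ cong (_+ e * leading₂-count i) (*-zeroʳ k) ⟩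
          e * leading₂-count i
            ≤⟨ times≤ e (leading₂-count≤1 i) ⟩
          e
            ≤⟨ e≤k ⟩
          k ∎
        ... | inj₂ _ | inj₁ z = begin
          k * leading-count i + e * leading₂-count i
            ≡⟨ cong (λ c → k * leading-count i + e * c) z ⟩
          k * leading-count i + e * 0
            ≡⟨ ≡-trans (cong (k * leading-count i +_) (*-zeroʳ e)) (+-identityʳ _) ⟩
          k * leading-count i
            ≤⟨ times≤ k (leading-count≤1 i) ⟩
          k ∎
        ... | inj₂ (A , A∈ , l) | inj₂ (A′ , A′∈ , l₂) = ⊥-elim (leading-leading₂ i n<3k A∈ A′∈ l l₂)

      cut-free : ∀ {G} j → G ∈ sets → isolated G ≡ true → Arc G j ⊎ Arc G (j + (r + k′)) →
        leading-count j ≡ 0 × leadingEnd-count j ≡ 0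
      cut-free {G} j G∈ iso g = ∑-zero sets no-leading , ∑-zero sets no-leadingEnd
        where
        no-leading : ∀ {A} → A ∈ sets → ⟦ leading A (cut j) ⟧ ≡ 0
        no-leading {A} A∈ with leading A (cut j) in l
        ... | false = refl
        ... | true with leading⇒Leads A∈ l
        ...   | ni , L = ⊥-elim (isolated-free j G∈ A∈ (mate∈ A∈ ni) (mate-disj A∈ ni) (Leads.order L) iso g)
        no-leadingEnd : ∀ {A} → A ∈ sets → ⟦ leadingEnd A j ⟧ ≡ 0
        no-leadingEnd {A} A∈ with leadingEnd A j in l
        ... | false = refl
        ... | true with leadingEnd⇒Before {A} {j} l
        ...   | ni , _ , h = ⊥-elim (isolated-free j G∈ (mate∈ A∈ ni) A∈
          (Disj-sym {A = A} {mate A} (mate-disj A∈ ni)) h iso g)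

      opposite-arcs : ∀ {G G′} j → G ∈ sets → G′ ∈ sets → isolated G ≡ true → Arc G j → ¬ Arc G′ (j + (r + k′))
      opposite-arcs j G∈ G′∈ iso g g′ = arcs-overlap {i = j} {j = j + (r + k′)} G∈ G′∈ iso g g′
        (+-monoʳ-≤ j (+-monoˡ-≤ k′ 0<r))
        (≤-reflexive (wrap j))

      -- An isolated arc starting at `j` and one ending there would be disjoint, so at most one is
      -- present, and it excludes every separated pair at this cut. With no such arc, at most one
      -- pair is counted in each direction, and 2(k + e) ≤ n suffices.
      cut-bound : ∀ j →
        n * (arc-count j + arc-count (j + (r + k′))) + (k + e) * (leading-count j + leadingEnd-count j) ≤ n
      cut-bound j with ∑-⟦⟧-positive sets (λ A → arcs A (cut j))
                         | ∑-⟦⟧-positive sets (λ A → arcs A (cut (j + (r + k′))))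
      ... | inj₂ (G , G∈ , a) | inj₂ (G′ , G′∈ , a′) with arcs⇒Arc {G} {j} a | arcs⇒Arc {G′} {j + (r + k′)} a′
      ...   | iso , g | _ , g′ = ⊥-elim (opposite-arcs j G∈ G′∈ iso g g′)
      cut-bound j | inj₁ z | inj₁ z′ = begin
        n * (arc-count j + arc-count (j + (r + k′))) + (k + e) * (leading-count j + leadingEnd-count j)
          ≡⟨ cong₂ (λ a b → n * (a + b) + (k + e) * (leading-count j + leadingEnd-count j)) z z′ ⟩
        n * 0 + (k + e) * (leading-count j + leadingEnd-count j)
          ≡⟨ cong (_+ (k + e) * (leading-count j + leadingEnd-count j)) (*-zeroʳ n) ⟩
        (k + e) * (leading-count j + leadingEnd-count j)
          ≤⟨ *-monoʳ-≤ (k + e) (+-mono-≤ (leading-count≤1 j) (leadingEnd-count≤1 j)) ⟩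
        (k + e) * 2
          ≡⟨ *-comm (k + e) 2 ⟩
        2 * (k + e)
          ≤⟨ 2[k+e]≤n ⟩
        n ∎
        where open ≤-Reasoning
      cut-bound j | inj₂ (G , G∈ , a) | inj₁ z′ with arcs⇒Arc {G} {j} a
      ... | iso , g with cut-free j G∈ iso (inj₁ g)
      ...   | z₁ , z₂ = begin
        n * (arc-count j + arc-count (j + (r + k′))) + (k + e) * (leading-count j + leadingEnd-count j)
          ≡⟨ cong₂ (λ b c → n * (arc-count j + b) + (k + e) * c) z′ (cong₂ _+_ z₁ z₂) ⟩
        n * (arc-count j + 0) + (k + e) * 0
          ≡⟨ cong₂ _+_ (cong (n *_) (+-identityʳ _)) (*-zeroʳ (k + e)) ⟩
        n * arc-count j + 0
          ≡⟨ +-identityʳ _ ⟩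
        n * arc-count j
          ≤⟨ *-monoʳ-≤ n (arc-count≤1 j) ⟩
        n * 1
          ≡⟨ *-identityʳ n ⟩
        n ∎
        where open ≤-Reasoning
      cut-bound j | inj₁ z | inj₂ (G , G∈ , a) with arcs⇒Arc {G} {j + (r + k′)} a
      ... | iso , g with cut-free j G∈ iso (inj₂ g)
      ...   | z₁ , z₂ = begin
        n * (arc-count j + arc-count (j + (r + k′))) + (k + e) * (leading-count j + leadingEnd-count j)
          ≡⟨ cong₂ (λ b c → n * (b + arc-count (j + (r + k′))) + (k + e) * c) z (cong₂ _+_ z₁ z₂) ⟩
        n * arc-count (j + (r + k′)) + (k + e) * 0
          ≡⟨ cong (n * arc-count (j + (r + k′)) +_) (*-zeroʳ (k + e)) ⟩
        n * arc-count (j + (r + k′)) + 0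
          ≡⟨ +-identityʳ _ ⟩
        n * arc-count (j + (r + k′))
          ≤⟨ *-monoʳ-≤ n (arc-count≤1 (j + (r + k′))) ⟩
        n * 1
          ≡⟨ *-identityʳ n ⟩
        n ∎
        where open ≤-Reasoning

      -- Cyclic orders in which an isolated member is an arc

      module WithArc {F : Subset n} (F∈ : F ∈ sets) (isoF : isolated F ≡ true) (f : Arc F 0) where

        far-arc-count : ∀ s → s < r → arc-count (k + s) ≡ 0
        far-arc-count s s<r with ∑-⟦⟧-positive sets (λ A → arcs A (cut (k + s)))
        ... | inj₁ z = z
        ... | inj₂ (A , A∈ , a) = ⊥-elim (arcs-overlap {i = 0} {j = k + s} F∈ A∈ isoF f
                (proj₂ (arcs⇒Arc {A} {k + s} a)) (m≤m+n k s) far)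
          where
          far : k + s + k ≤ n
          far = begin
            k + s + k       ≡⟨ +-assoc k s k ⟩
            k + (s + k)     ≡⟨ cong (k +_) (+-suc s k′) ⟩
            k + (suc s + k′) ≤⟨ +-monoʳ-≤ k (+-monoˡ-≤ k′ s<r) ⟩
            k + (r + k′)    ≡⟨ n-split ⟨
            n ∎
            where open ≤-Reasoning

        -- Katona's pairing: the arcs starting at k, ..., k + r - 1 miss F and cannot occur. Any arc
        -- other than F that meets F starts or ends at exactly one of the k - 1 cuts inside F, and
        -- those that end at `suc t` start at `suc t + (r + k′)`.
        arc-sum : ∑ (upTo n) arc-count ≤ 1 + ∑ (upTo k′) (λ t → arc-count (suc t) + arc-count (suc t + (r + k′)))
        arc-sum = begin
          ∑ (upTo n) arc-count
            ≡⟨ cong (λ m → ∑ (upTo m) arc-count) n-split ⟩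
          ∑ (upTo (suc (k′ + (r + k′)))) arc-count
            ≡⟨ ∑-upTo-suc (k′ + (r + k′)) arc-count ⟩
          arc-count 0 + ∑ (upTo (k′ + (r + k′))) (arc-count ∘ suc)
            ≡⟨ cong (arc-count 0 +_) (≡-trans (∑-upTo-+ k′ (r + k′) (arc-count ∘ suc))
                 (cong (∑ (upTo k′) (arc-count ∘ suc) +_) (∑-upTo-+ r k′ (λ i → arc-count (k + i))))) ⟩
          arc-count 0 + (∑ (upTo k′) (arc-count ∘ suc) +
            (∑ (upTo r) (λ s → arc-count (k + s)) + ∑ (upTo k′) (λ t → arc-count (k + (r + t)))))
            ≡⟨ cong₂ (λ a b → arc-count 0 + (∑ (upTo k′) (arc-count ∘ suc) + (a + b)))
                 (∑-zero (upTo r) (λ {s} s∈ → far-arc-count s (∈-upTo⁻ s∈)))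
                 (∑-cong (upTo k′) (λ t → cong arc-count (cong suc (reindex k′ r t)))) ⟩
          arc-count 0 + (∑ (upTo k′) (arc-count ∘ suc) + ∑ (upTo k′) (λ t → arc-count (suc t + (r + k′))))
            ≡⟨ cong (arc-count 0 +_) (∑-+ (upTo k′) _ _) ⟨
          arc-count 0 + ∑ (upTo k′) (λ t → arc-count (suc t) + arc-count (suc t + (r + k′)))
            ≤⟨ +-monoˡ-≤ _ (arc-count≤1 0) ⟩
          1 + ∑ (upTo k′) (λ t → arc-count (suc t) + arc-count (suc t + (r + k′))) ∎
          where
          open ≤-Reasoning
          reindex : ∀ a b c → a + (b + c) ≡ c + (b + a)
          reindex = solve-∀

        -- Around the circle `A` leads at most once, and each `leading₂` cut is followed by a
        -- leading cut, so `A` weighs at most k + e. By `gap-inside` this weight can be charged to a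
        -- cut inside F.
        leading-sum : ∀ {A} → A ∈ sets →
          ∑ (upTo n) (λ i → k * ⟦ leading A (cut i) ⟧ + e * ⟦ leading₂ A (cut i) ⟧) ≤
          (k + e) * ∑ (upTo k′) (λ t → ⟦ leading A (cut (suc t)) ⟧ + ⟦ leadingEnd A (suc t) ⟧)
        leading-sum {A} A∈ = begin
          ∑ (upTo n) (λ i → k * ⟦ leading A (cut i) ⟧ + e * ⟦ leading₂ A (cut i) ⟧)
            ≡⟨ ≡-trans (∑-+ (upTo n) (λ i → k * ⟦ leading A (cut i) ⟧) _) (cong₂ _+_ (∑-*ˡ (upTo n) k _) (∑-*ˡ (upTo n) e _)) ⟩
          k * S + e * ∑ (upTo n) (λ i → ⟦ leading₂ A (cut i) ⟧)
            ≤⟨ +-monoʳ-≤ (k * S) (*-monoʳ-≤ e (leading₂-sum A∈)) ⟩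
          k * S + e * S
            ≡⟨ *-distribʳ-+ S k e ⟨
          (k + e) * S
            ≤⟨ *-monoʳ-≤ (k + e) S≤ ⟩
          (k + e) * ∑ (upTo k′) ends ∎
          where
          open ≤-Reasoning
          S : ℕ
          S = ∑ (upTo n) (λ i → ⟦ leading A (cut i) ⟧)
          ends : ℕ → ℕ
          ends t = ⟦ leading A (cut (suc t)) ⟧ + ⟦ leadingEnd A (suc t) ⟧
          S≤ : S ≤ ∑ (upTo k′) ends
          S≤ with ∑-⟦⟧-positive (upTo n) (λ i → leading A (cut i))
          ... | inj₁ z = subst (_≤ ∑ (upTo k′) ends) (sym z) z≤n
          ... | inj₂ (i , i∈ , l) with leading⇒Leads A∈ l
          ...   | ni , L with gap-inside F∈ isoF f A∈ ni L (∈-upTo⁻ i∈)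
          ...     | t , t<k′ , hit = ≤-trans (leads-once A∈) (≤-trans (one hit) (∈-∑ ends (∈-upTo⁺ t<k′)))
            where
            one : leading A (cut (suc t)) ≡ true ⊎ leadingEnd A (suc t) ≡ true → 1 ≤ ends t
            one (inj₁ h) = subst (λ b → 1 ≤ ⟦ b ⟧ + ⟦ leadingEnd A (suc t) ⟧) (sym h) (s≤s z≤n)
            one (inj₂ h) = subst (λ b → 1 ≤ ⟦ leading A (cut (suc t)) ⟧ + ⟦ b ⟧) (sym h) (m≤n+m 1 _)

        total-sum : ∑ (upTo n) total ≤ n * k
        total-sum = begin
          ∑ (upTo n) total
            ≡⟨ ∑-cong (upTo n) (λ i → ∑-+ sets (λ A → n * ⟦ arcs A (cut i) ⟧) _) ⟩
          ∑ (upTo n) (λ i → ∑ sets (λ A → n * ⟦ arcs A (cut i) ⟧) + ∑ sets (λ A → w A i))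
            ≡⟨ ∑-+ (upTo n) (λ i → ∑ sets (λ A → n * ⟦ arcs A (cut i) ⟧)) _ ⟩
          ∑ (upTo n) (λ i → ∑ sets (λ A → n * ⟦ arcs A (cut i) ⟧)) + ∑ (upTo n) (λ i → ∑ sets (λ A → w A i))
            ≡⟨ cong₂ _+_ (≡-trans (∑-cong (upTo n) (λ i → ∑-*ˡ sets n _)) (∑-*ˡ (upTo n) n _))
                 (∑-comm (upTo n) sets (λ i A → w A i)) ⟩
          n * ∑ (upTo n) arc-count + ∑ sets (λ A → ∑ (upTo n) (w A))
            ≤⟨ +-mono-≤ (*-monoʳ-≤ n arc-sum) (∑-mono sets leading-sum) ⟩
          n * (1 + ∑ (upTo k′) a) + ∑ sets (λ A → (k + e) * ∑ (upTo k′) (λ t → b A t))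
            ≡⟨ cong₂ _+_ (*-distribˡ-+ n 1 _) (∑-*ˡ sets (k + e) _) ⟩
          n * 1 + n * ∑ (upTo k′) a + (k + e) * ∑ sets (λ A → ∑ (upTo k′) (λ t → b A t))
            ≡⟨ cong₂ (λ x y → x + n * ∑ (upTo k′) a + (k + e) * y) (*-identityʳ n) swapped ⟩
          n + n * ∑ (upTo k′) a + (k + e) * ∑ (upTo k′) c
            ≡⟨ +-assoc n _ _ ⟩
          n + (n * ∑ (upTo k′) a + (k + e) * ∑ (upTo k′) c)
            ≡⟨ cong (n +_) (≡-trans (∑-+ (upTo k′) _ _) (cong₂ _+_ (∑-*ˡ (upTo k′) n a) (∑-*ˡ (upTo k′) (k + e) c))) ⟨
          n + ∑ (upTo k′) (λ t → n * a t + (k + e) * c t)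
            ≤⟨ +-monoʳ-≤ n (∑-mono (upTo k′) (λ {t} _ → cut-bound (suc t))) ⟩
          n + ∑ (upTo k′) (λ _ → n)
            ≡⟨ cong (n +_) (≡-trans (∑-const (upTo k′) n) (cong (_* n) (length-upTo k′))) ⟩
          k * n
            ≡⟨ *-comm k n ⟩
          n * k ∎
          where
          open ≤-Reasoning
          w b : Subset n → ℕ → ℕ
          w A i = k * ⟦ leading A (cut i) ⟧ + e * ⟦ leading₂ A (cut i) ⟧
          b A t = ⟦ leading A (cut (suc t)) ⟧ + ⟦ leadingEnd A (suc t) ⟧
          a c : ℕ → ℕ
          a t = arc-count (suc t) + arc-count (suc t + (r + k′))
          c t = leading-count (suc t) + leadingEnd-count (suc t)
          swapped : ∑ sets (λ A → ∑ (upTo k′) (b A)) ≡ ∑ (upTo k′) c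
          swapped = ≡-trans (∑-comm sets (upTo k′) b) (∑-cong (upTo k′) (λ t → ∑-+ sets _ _))

    cycle-bound : (O : CyclicOrder n) → ∑ (upTo n) (At.total O) ≤ n * k
    cycle-bound O with any? (λ i → any? (λ A → arcs A (Cuts.cut M O i) Bool.≟ true) sets) (upTo n)
    ... | no none-arc = begin
      ∑ (upTo n) total
        ≤⟨ ∑-mono (upTo n) (λ {i} i∈ → total≤k i (∑-zero sets (λ {A} A∈ → cong ⟦_⟧
             (Bool.¬-not (λ a → none-arc (lose i∈ (lose A∈ a))))))) ⟩
      ∑ (upTo n) (λ _ → k)
        ≡⟨ ≡-trans (∑-const (upTo n) k) (cong (_* k) (length-upTo n)) ⟩
      n * k ∎
      where
      open ≤-Reasoning
      open At O
    ... | yes some-arc with find some-arc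
    ...   | s , s∈ , some with find some
    ...     | F , F∈ , a = begin
      ∑ (upTo n) (At.total O)
        -- Recutting the circle at `s` lets the arc F begin at position 0.
        ≡⟨ ∑-upTo-shift n s (At.total O) (λ i → cong (λ l → ∑ sets (λ A → weight A l)) (At.cut-periodic O i)) ⟨
      ∑ (upTo n) (λ i → At.total O (s + i))
        ≡⟨ ∑-cong (upTo n) (λ i → cong (λ l → ∑ sets (λ A → weight A l)) (recut i)) ⟩
      ∑ (upTo n) (At.total (shift s O))
        ≤⟨ At.WithArc.total-sum (shift s O) F∈ (proj₁ isArc) (proj₂ isArc) ⟩
      n * k ∎
      where
      open ≤-Reasoning
      recut : ∀ i → Cuts.cut M O (s + i) ≡ Cuts.cut M (shift s O) i
      recut i = applyUpTo-cong n (λ j _ → cong (CyclicOrder.at O) (+-assoc s i j))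
      isArc : isolated F ≡ true × Cuts.Arc M (shift s O) F 0
      isArc = At.arcs⇒Arc (shift s O) {F} {0} (subst (λ l → arcs F l ≡ true)
        (≡-trans (cong (Cuts.cut M O) (sym (+-identityʳ s))) (recut 0)) a)

  -- Orderings as cyclic orders

  nth : ∀ {X : Set} → X → List X → ℕ → X
  nth d [] i = d
  nth d (x ∷ l) zero = x
  nth d (x ∷ l) (suc i) = nth d l i

  nth-∈ : ∀ {X : Set} (d : X) (l : List X) {i} → i < length l → nth d l i ∈ l
  nth-∈ d (x ∷ l) {zero} _ = here refl
  nth-∈ d (x ∷ l) {suc i} (s≤s i<) = there (nth-∈ d l i<)

  ∈-nth : ∀ {X : Set} (d : X) (l : List X) {x} → x ∈ l → ∃ λ i → i < length l × nth d l i ≡ x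
  ∈-nth d (x ∷ l) (here refl) = 0 , z<s , refl
  ∈-nth d (x ∷ l) (there x∈) with ∈-nth d l x∈
  ... | i , i< , eq = suc i , s<s i< , eq

  nth-injective : ∀ {X : Set} (d : X) (l : List X) → Unique l → ∀ {p q} → p < q → q < length l →
    nth d l p ≢ nth d l q
  nth-injective d (x ∷ l) (x∉ ∷ u) {zero} {suc q} p<q (s≤s q<) = All.lookup x∉ (nth-∈ d l q<)
  nth-injective d (x ∷ l) (x∉ ∷ u) {suc p} {suc q} (s≤s p<q) (s≤s q<) = nth-injective d l u p<q q<

  applyUpTo-nth : ∀ {X : Set} (d : X) (l : List X) → applyUpTo (nth d l) (length l) ≡ l
  applyUpTo-nth d [] = refl
  applyUpTo-nth d (x ∷ l) = cong (x ∷_) (applyUpTo-nth d l)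

  rotateBy-applyUpTo : ∀ {X : Set} i m (g : ℕ → X) → (∀ j → g (j + m) ≡ g j) →
    rotateBy i (applyUpTo g m) ≡ applyUpTo (λ j → g (i + j)) m
  rotateBy-applyUpTo zero m g per = refl
  rotateBy-applyUpTo (suc i) m g per =
    ≡-trans (cong (rotateBy i) (once m per)) (rotateBy-applyUpTo i m (g ∘ suc) (per ∘ suc))
    where
    once : ∀ m → (∀ j → g (j + m) ≡ g j) → rotate (applyUpTo g m) ≡ applyUpTo (g ∘ suc) m
    once zero per = refl
    once (suc m) per = ≡-trans (cong (applyUpTo (g ∘ suc) m ∷ʳ_) (sym (per 0))) (applyUpTo-∷ʳ (g ∘ suc) m)

  module FromOrdering (n′ : ℕ) {l : List (Fin (suc n′))} (l↭ : l ↭ allFin (suc n′)) where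
    private
      n : ℕ
      n = suc n′

      length-l : length l ≡ n
      length-l = ≡-trans (↭-length l↭) (length-tabulate (λ x → x))

    at : ℕ → Fin n
    at i = nth zero l (i % n)

    at< : ∀ {i} → i < n → at i ≡ nth zero l i
    at< i<n = cong (nth zero l) (m<n⇒m%n≡m i<n)

    periodic : ∀ i → at (i + n) ≡ at i
    periodic i = cong (nth zero l) ([m+n]%n≡m%n i n)

    -- The window slides by one step at a time: the new position `i + n` carries the element of the
    -- dropped position `i`. The same induction gives `surjective`.
    injective : ∀ i {p q} → i ≤ p → p < q → q < i + n → at p ≢ at q
    injective zero {p} {q} _ p<q q<n eq = nth-injective zero l
      (Unique-resp-↭ (setoid (Fin n)) (↭⇒↭ₛ (↭-sym l↭)) (allFin⁺ n)) p<q
      (subst (q <_) (sym length-l) q<n)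
      (≡-trans (sym (at< (<-trans p<q q<n))) (≡-trans eq (at< q<n)))
    injective (suc i) {p} {q} i<p p<q q< eq with m≤n⇒m<n∨m≡n (≤-pred q<)
    ... | inj₁ q<i+n = injective i (<⇒≤ i<p) p<q q<i+n eq
    ... | inj₂ refl = injective i ≤-refl i<p p<q (≡-trans (sym (periodic i)) (sym eq))

    surjective : ∀ i x → ∃ λ p → i ≤ p × p < i + n × at p ≡ x
    surjective zero x with ∈-nth zero l (∈-resp-↭ (↭-sym l↭) (∈-allFin x))
    ... | p , p< , eq = p , z≤n , p<n , ≡-trans (at< p<n) eq
      where
      p<n : p < n
      p<n = subst (p <_) length-l p<
    surjective (suc i) x with surjective i x
    ... | p , i≤p , p< , eq with m≤n⇒m<n∨m≡n i≤p
    ...   | inj₁ i<p = p , i<p , m≤n⇒m≤1+n p< , eq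
    ...   | inj₂ refl = i + n , m<m+n i z<s , ≤-refl , ≡-trans (periodic i) eq

    order : CyclicOrder n
    order = record { at = at ; periodic = periodic ; injective = injective ; surjective = surjective }

    rotations : ∀ i → rotateBy i l ≡ applyUpTo (λ j → at (i + j)) n
    rotations i = ≡-trans (cong (rotateBy i) (sym spelled)) (rotateBy-applyUpTo i n at periodic)
      where
      spelled : applyUpTo at n ≡ l
      spelled = ≡-trans (applyUpTo-cong n (λ j j<n → at< j<n))
        (≡-trans (cong (applyUpTo (nth zero l)) (sym length-l)) (applyUpTo-nth zero l))

  -- Averaging over all orderings

  LeadCount LeadCount₂ : ∀ {n} → Subset n → Subset n → ℕ
  LeadCount {n} A B = ∑ (orderings n (allFin n)) (λ l → ⟦ leads (lookup A) (lookup B) l ⟧)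
  LeadCount₂ {n} A B = ∑ (orderings n (allFin n)) (λ l → ⟦ leadsSecond (lookup A) (lookup B) l ⟧)

  -- The left side of `enough` is the total weight of an isolated member over all orderings; the
  -- hypothesis says that every other member weighs at least as much.
  module Averaging (k′ r e : ℕ) (0<r : 0 < r)
    (2[k+e]≤n : 2 * (suc k′ + e) ≤ suc k′ + (r + k′)) (e≤k : e ≤ suc k′)
    (e-free : e ≡ 0 ⊎ suc k′ + (r + k′) < 3 * suc k′)
    (M : MatedFamily (suc k′ + (r + k′)) (suc k′))
    (enough : ∀ (A B : Subset (suc k′ + (r + k′))) → ∣ A ∣ ≡ suc k′ → ∣ B ∣ ≡ suc k′ → Disj A B →
      (suc k′ + (r + k′)) * (suc k′ ! * (r + k′) !) ≤ suc k′ * LeadCount A B + e * LeadCount₂ A B) where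
    open MatedFamily M
    open Weights (suc k′ + (r + k′)) (suc k′) e M
    open CycleBound (k′ + (r + k′)) k′ r e refl 0<r 2[k+e]≤n e≤k e-free M

    private
      n′ n k o : ℕ
      n′ = k′ + (r + k′)
      n = suc n′
      k = suc k′
      o = r + k′

      Ω : List (List (Fin n))
      Ω = orderings n (allFin n)

      length-allFin : length (allFin n) ≡ n
      length-allFin = length-tabulate (λ x → x)

    weight-sum : ∀ {A} → A ∈ sets → n * (k ! * o !) ≤ ∑ Ω (weight A)
    weight-sum {A} A∈ with isolated A in iso
    ... | true = begin
      n * (k ! * o !)
        ≡⟨ cong (n *_) (∑-orderings-prefixIs k o (allFin n) (lookup A) length-allFin
             (≡-trans (count-allFin A) (size A∈))) ⟨
      n * ∑ Ω (λ l → ⟦ prefixIs (lookup A) k l ⟧)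
        ≡⟨ ∑-*ˡ Ω n _ ⟨
      ∑ Ω (λ l → n * ⟦ prefixIs (lookup A) k l ⟧)
        ≤⟨ ∑-mono Ω (λ _ → m≤m+n _ _) ⟩
      _ ∎
      where open ≤-Reasoning
    ... | false = begin
      n * (k ! * o !)
        ≤⟨ enough A (mate A) (size A∈) (size (mate∈ A∈ iso)) (mate-disj A∈ iso) ⟩
      k * LeadCount A (mate A) + e * LeadCount₂ A (mate A)
        ≡⟨ cong₂ _+_ (∑-*ˡ Ω k _) (∑-*ˡ Ω e _) ⟨
      ∑ Ω (λ l → k * ⟦ leads (lookup A) (lookup (mate A)) l ⟧) +
        ∑ Ω (λ l → e * ⟦ leadsSecond (lookup A) (lookup (mate A)) l ⟧)
        ≡⟨ ∑-+ Ω _ _ ⟨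
      ∑ Ω (λ l → k * ⟦ leads (lookup A) (lookup (mate A)) l ⟧ +
                 e * ⟦ leadsSecond (lookup A) (lookup (mate A)) l ⟧)
        ≤⟨ ∑-mono Ω (λ _ → m≤n+m _ (n * 0)) ⟩
      _ ∎
      where open ≤-Reasoning

    -- The outer factor n stands for the n cuts. By rotation invariance every cut contributes the
    -- same sum over all orderings, and collecting the n cuts of one ordering gives the sum bounded
    -- by `cycle-bound`.
    double-count : n * (length sets * (n * (k ! * o !))) ≤ n ! * (n * k)
    double-count = begin
      n * (length sets * (n * (k ! * o !)))
        ≡⟨ cong (n *_) (∑-const sets _) ⟨
      n * ∑ sets (λ _ → n * (k ! * o !))
        ≤⟨ *-monoʳ-≤ n (∑-mono sets weight-sum) ⟩
      n * ∑ sets (λ A → ∑ Ω (weight A))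
        ≡⟨ cong (n *_) (∑-comm sets Ω weight) ⟩
      n * ∑ Ω g
        ≡⟨ cong (_* ∑ Ω g) (length-upTo n) ⟨
      length (upTo n) * ∑ Ω g
        ≡⟨ ∑-const (upTo n) _ ⟨
      ∑ (upTo n) (λ i → ∑ Ω g)
        ≡⟨ ∑-cong (upTo n) (λ i → ∑-orderings-rotateBy i n (allFin n) g) ⟨
      ∑ (upTo n) (λ i → ∑ Ω (λ l → g (rotateBy i l)))
        ≡⟨ ∑-comm (upTo n) Ω (λ i l → g (rotateBy i l)) ⟩
      ∑ Ω (λ l → ∑ (upTo n) (λ i → g (rotateBy i l)))
        ≤⟨ ∑-mono Ω (λ l∈ → one-cycle (orderings-↭ n (allFin n) length-allFin l∈)) ⟩
      ∑ Ω (λ _ → n * k)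
        ≡⟨ ∑-*ʳ′ ⟩
      ∑ Ω (λ _ → 1) * (n * k)
        ≡⟨ cong (_* (n * k)) (∑-orderings-1 n (allFin n) length-allFin) ⟩
      n ! * (n * k) ∎
      where
      open ≤-Reasoning
      g : List (Fin n) → ℕ
      g l = ∑ sets (λ A → weight A l)
      ∑-*ʳ′ : ∑ Ω (λ _ → n * k) ≡ ∑ Ω (λ _ → 1) * (n * k)
      ∑-*ʳ′ = ≡-trans (∑-cong Ω (λ _ → sym (*-identityˡ (n * k)))) (∑-*ʳ Ω (n * k) (λ _ → 1))
      one-cycle : ∀ {l} → l ↭ allFin n → ∑ (upTo n) (λ i → g (rotateBy i l)) ≤ n * k
      one-cycle l↭ = ≤-trans
        (≤-reflexive (∑-cong (upTo n) (λ i → cong g (FromOrdering.rotations n′ l↭ i))))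
        (cycle-bound (FromOrdering.order n′ l↭))

    size-bound : length sets ≤ n′ C k′
    size-bound = begin
      length sets
        ≡⟨ m*n/n≡m (length sets) (k′ ! * o !) ⟨
      (length sets * (k′ ! * o !)) / (k′ ! * o !)
        ≤⟨ /-monoˡ-≤ (k′ ! * o !) cancelled ⟩
      n′ ! / (k′ ! * o !)
        ≡⟨ /-congʳ (cong (λ m → k′ ! * m !) (sym (m+n∸m≡n k′ o))) ⟩
      n′ ! / (k′ ! * (n′ ∸ k′) !)
        ≡⟨ nCk≡n!/k![n-k]! (m≤m+n k′ o) ⟨
      n′ C k′ ∎
      where
      open ≤-Reasoning
      instance
        _ = k′ !* o !≢0
        _ = k′ !* (n′ ∸ k′) !≢0
      cancelled : length sets * (k′ ! * o !) ≤ n′ !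
      cancelled = *-cancelˡ-≤ (n * (n * k)) (begin
        n * (n * k) * (length sets * (k′ ! * o !))
          ≡⟨ gather n k (length sets) (k′ !) (o !) ⟩
        n * (length sets * (n * (k * k′ ! * o !)))
          ≤⟨ double-count ⟩
        n * n′ ! * (n * k)
          ≡⟨ regroup n k (n′ !) ⟩
        n * (n * k) * n′ ! ∎)
        where
        gather : ∀ n k L a b → n * (n * k) * (L * (a * b)) ≡ n * (L * (n * (k * a * b)))
        gather = solve-∀
        regroup : ∀ n k f → n * f * (n * k) ≡ n * (n * k) * f
        regroup = solve-∀

  -- The numerical inequality

  LeadCount-formula : ∀ k′ m o → m ≡ suc k′ + o → (A B : Subset (suc k′ + m)) →
    ∣ A ∣ ≡ suc k′ → ∣ B ∣ ≡ suc k′ → Disj A B →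
    LeadCount A B * (k′ + suc k′) ! ≡ suc k′ * ((k′ + m) ! * (k′ ! * suc k′ !))
  LeadCount-formula k′ m o m≡ A B a b d = ∑-orderings-leads (k′ + m) k′ (suc k′) o _ (lookup A) (lookup B) d
    (≡-trans (cong (k′ +_) m≡) (sym (+-assoc k′ (suc k′) o))) (length-tabulate (λ x → x)) (≡-trans (count-allFin A) a) (≡-trans (count-allFin B) b)

  -- n · k!(n-k)! ≤ k · LeadCount with k = suc k′ and n = k + o, after clearing denominators.
  Enough : ℕ → ℕ → Set
  Enough k′ o = (suc k′ + o) * (o ! * (k′ + suc k′) !) ≤ suc k′ * (suc k′ ! * (k′ + o) !)

  -- Passing to o + 1 multiplies the left side by (k + o + 1)(o + 1) / (k + o) and the right side by
  -- k + o. The added polynomial is (k + o)² - (k + o + 1)(o + 1) = k² - k - 1 + (k - 2)o at k = 4 +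
  -- c.
  Enough-step : ∀ c o → Enough (3 + c) o → Enough (3 + c) (suc o)
  Enough-step c o h = begin
    (k + suc o) * (suc o * o ! * F)
      ≡⟨ left c o (o !) F ⟩
    (k + suc o) * suc o * (o ! * F)
      ≤⟨ *-monoˡ-≤ (o ! * F) (m≤m+n ((k + suc o) * suc o) (c * c + 7 * c + 11 + (2 + c) * o)) ⟩
    ((k + suc o) * suc o + (c * c + 7 * c + 11 + (2 + c) * o)) * (o ! * F)
      ≡⟨ slack c o (o ! * F) ⟩
    (k + o) * ((k + o) * (o ! * F))
      ≤⟨ *-monoʳ-≤ (k + o) h ⟩
    (k + o) * (k * (k ! * (3 + c + o) !))
      ≡⟨ right c o (k !) ((3 + c + o) !) ⟩
    k * (k ! * suc (3 + c + o) !)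
      ≡⟨ cong (λ m → k * (k ! * m !)) (+-suc (3 + c) o) ⟨
    k * (k ! * (3 + c + suc o) !) ∎
    where
    open ≤-Reasoning
    k F : ℕ
    k = 4 + c
    F = (3 + c + k) !
    left : ∀ c o f g → (4 + c + suc o) * (suc o * f * g) ≡ (4 + c + suc o) * suc o * (f * g)
    left = solve-∀
    slack : ∀ c o f → ((4 + c + suc o) * suc o + (c * c + 7 * c + 11 + (2 + c) * o)) * f ≡
      (4 + c + o) * ((4 + c + o) * f)
    slack = solve-∀
    right : ∀ c o f g → (4 + c + o) * ((4 + c) * (f * g)) ≡ (4 + c) * (f * ((4 + c + o) * g))
    right = solve-∀

  -- This is n = 2k + 2 with k = 5 + c. Cancelling k! (2k-1)! leaves (2k + 2)(k + 2)(k + 1) ≤ k (2k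
  -- + 1)(2k), whose slack is 46 at k = 5; at k = 4 it would read 300 ≤ 288.
  Enough-base : ∀ c → Enough (4 + c) (5 + c + 2)
  Enough-base c = base
    where
    k k′ : ℕ
    k = 5 + c
    k′ = 4 + c
    open ≤-Reasoning
    base : (k + (k + 2)) * ((k + 2) ! * (k′ + k) !) ≤ k * (k ! * (k′ + (k + 2)) !)
    base = begin
      (k + (k + 2)) * ((k + 2) ! * (k′ + k) !)
        ≡⟨ cong (λ m → (k + (k + 2)) * (m ! * (k′ + k) !)) (+-comm k 2) ⟩
      (k + (k + 2)) * ((2 + k) * ((1 + k) * k !) * (k′ + k) !)
        ≡⟨ left c (k !) ((k′ + k) !) ⟩
      (k + (k + 2)) * (2 + k) * (1 + k) * (k ! * (k′ + k) !)
        ≤⟨ *-monoˡ-≤ (k ! * (k′ + k) !) (m≤m+n ((k + (k + 2)) * (2 + k) * (1 + k)) (2 * c * c * c + 24 * c * c + 80 * c + 46)) ⟩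
      ((k + (k + 2)) * (2 + k) * (1 + k) + (2 * c * c * c + 24 * c * c + 80 * c + 46)) * (k ! * (k′ + k) !)
        ≡⟨ cong (_* (k ! * (k′ + k) !)) (slack c) ⟩
      k * (2 + (k′ + k)) * (1 + (k′ + k)) * (k ! * (k′ + k) !)
        ≡⟨ right c (k !) ((k′ + k) !) ⟩
      k * (k ! * ((2 + (k′ + k)) * ((1 + (k′ + k)) * (k′ + k) !)))
        ≡⟨ cong (λ m → k * (k ! * m !)) (reorder c) ⟩
      k * (k ! * (k′ + (k + 2)) !) ∎
      where
      left : ∀ c f g → ((5 + c) + ((5 + c) + 2)) * ((2 + (5 + c)) * ((1 + (5 + c)) * f) * g) ≡
        ((5 + c) + ((5 + c) + 2)) * (2 + (5 + c)) * (1 + (5 + c)) * (f * g)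
      left = solve-∀
      right : ∀ c f g → (5 + c) * (2 + ((4 + c) + (5 + c))) * (1 + ((4 + c) + (5 + c))) * (f * g) ≡
        (5 + c) * (f * ((2 + ((4 + c) + (5 + c))) * ((1 + ((4 + c) + (5 + c))) * g)))
      right = solve-∀
      slack : ∀ c → ((5 + c) + ((5 + c) + 2)) * (2 + (5 + c)) * (1 + (5 + c)) + (2 * c * c * c + 24 * c * c + 80 * c + 46) ≡
        (5 + c) * (2 + ((4 + c) + (5 + c))) * (1 + ((4 + c) + (5 + c)))
      slack = solve-∀
      reorder : ∀ c → 2 + ((4 + c) + (5 + c)) ≡ (4 + c) + ((5 + c) + 2)
      reorder = solve-∀

  -- Induction on d, where n = 2k + 2 + d. Since (10,4) is excluded by 0 < c + d, the induction for
  -- k = 4 starts at n = 11, by computation.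
  enough-factorials : ∀ c d → 0 < c + d → Enough (3 + c) (4 + c + (2 + d))
  enough-factorials zero (suc zero) _ = ≤ᵇ⇒≤ (11 * (7 ! * 7 !)) (4 * (4 ! * 10 !)) _
  enough-factorials (suc c) zero _ = Enough-base c
  enough-factorials zero (suc (suc d)) _ = Enough-step 0 (7 + d) (enough-factorials zero (suc d) z<s)
  enough-factorials (suc c) (suc d) _ = subst (Enough (4 + c)) (sym (+-suc (5 + c) (2 + d)))
    (Enough-step (suc c) (5 + c + (2 + d)) (enough-factorials (suc c) d z<s))

  enough-leads : ∀ k′ m o → m ≡ suc k′ + o → Enough k′ m → (A B : Subset (suc k′ + m)) →
    ∣ A ∣ ≡ suc k′ → ∣ B ∣ ≡ suc k′ → Disj A B →
    (suc k′ + m) * (suc k′ ! * m !) ≤ suc k′ * LeadCount A B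
  enough-leads k′ m o m≡ h A B a b d = *-cancelʳ-≤ _ _ F (begin
    (k + m) * (k ! * m !) * F
      ≡⟨ left (k + m) (k !) (m !) F ⟩
    k ! * ((k + m) * (m ! * F))
      ≤⟨ *-monoʳ-≤ (k !) h ⟩
    k * k′ ! * (k * (k ! * (k′ + m) !))
      ≡⟨ right k (k′ !) (k !) ((k′ + m) !) ⟩
    k * (k * ((k′ + m) ! * (k′ ! * k !)))
      ≡⟨ cong (k *_) (LeadCount-formula k′ m o m≡ A B a b d) ⟨
    k * (LeadCount A B * F)
      ≡⟨ *-assoc k (LeadCount A B) F ⟨
    k * LeadCount A B * F ∎)
    where
    open ≤-Reasoning
    k F : ℕ
    k = suc k′
    F = (k′ + suc k′) !
    instance _ = (k′ + suc k′) !≢0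
    left : ∀ n a b f → n * (a * b) * f ≡ a * (n * (b * f))
    left = solve-∀
    right : ∀ k a b g → k * a * (k * (b * g)) ≡ k * (k * (g * (a * b)))
    right = solve-∀

  -- For n = 10, k = 4 the leading sets alone fall short: 4 · 41472 < 172800 ≤ 4 · 41472 + 9216.
  enough-10-4 : (A B : Subset 10) → ∣ A ∣ ≡ 4 → ∣ B ∣ ≡ 4 → Disj A B →
    10 * (4 ! * 6 !) ≤ 4 * LeadCount A B + 1 * LeadCount₂ A B
  enough-10-4 A B a b d = subst₂ (λ V Y → 10 * (4 ! * 6 !) ≤ 4 * V + 1 * Y) (sym V≡) (sym Y≡)
    (≤ᵇ⇒≤ (10 * (4 ! * 6 !)) (4 * 41472 + 1 * 9216) _)
    where
    -- 41472 = 4 · 9! · 3! · 4! / 7!, and below 9216 = 2 · 4 · 8! · 3! · 4! / 7!, where the factor 2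
    -- counts the elements outside both sets.
    V≡ : LeadCount A B ≡ 41472
    V≡ = *-cancelʳ-≡ (LeadCount A B) 41472 (7 !) (LeadCount-formula 3 6 2 refl A B a b d)
    rest : count (neither (lookup A) (lookup B)) (allFin 10) ≡ 2
    rest = +-cancelˡ-≡ 8 _ 2 (≡-trans
      (cong₂ (λ s t → s + t + count (neither (lookup A) (lookup B)) (allFin 10))
        (sym (≡-trans (count-allFin A) a)) (sym (≡-trans (count-allFin B) b)))
      (count-neither (lookup A) (lookup B) d (allFin 10)))
    Y≡ : LeadCount₂ A B ≡ 9216
    Y≡ = *-cancelʳ-≡ (LeadCount₂ A B) 9216 (7 !) (∑-orderings-leadsSecond 8 3 4 1 (allFin 10) (lookup A) (lookup B) d
      refl refl (≡-trans (count-allFin A) a) (≡-trans (count-allFin B) b) rest)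

  generic-bound : ∀ c d → 0 < c + d → (M : MatedFamily (4 + c + (3 + d + (3 + c))) (4 + c)) →
    length (MatedFamily.sets M) ≤ (3 + c + (3 + d + (3 + c))) C (3 + c)
  generic-bound c d 0<c+d M = Averaging.size-bound (3 + c) (3 + d) 0 z<s
    (≤-trans (m≤m+n _ (2 + d)) (≤-reflexive (twice c d))) z≤n (inj₁ refl) M
    (λ A B a b dis → ≤-trans (enough-leads (3 + c) (3 + d + (3 + c)) (2 + d) (split c d)
      (subst (Enough (3 + c)) (sym (split c d)) (enough-factorials c d 0<c+d)) A B a b dis) (m≤m+n _ 0))
    where
    split : ∀ c d → 3 + d + (3 + c) ≡ 4 + c + (2 + d)
    split = solve-∀
    twice : ∀ c d → 2 * (4 + c + 0) + (2 + d) ≡ 4 + c + (3 + d + (3 + c))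
    twice = solve-∀

  mated-bound : ∀ c d → (M : MatedFamily (4 + c + (3 + d + (3 + c))) (4 + c)) →
    length (MatedFamily.sets M) ≤ (3 + c + (3 + d + (3 + c))) C (3 + c)
  -- The case (10,4) with e = 1: here 2(k + e) equals n, and n < 3k = 12.
  mated-bound zero zero M = Averaging.size-bound 3 3 1 z<s ≤-refl (s≤s z≤n)
    (inj₂ (≤ᵇ⇒≤ 11 12 _)) M enough-10-4
  mated-bound zero (suc d) M = generic-bound 0 (suc d) z<s M
  mated-bound (suc c) d M = generic-bound (suc c) d z<s M

  -- From the given families to a mated family

  disj? : ∀ {n} (A B : Subset n) → Dec (Disj A B)
  disj? A B with disj-or-meets A B
  ... | inj₁ d = yes d
  ... | inj₂ m = no (λ d → Disj⇒¬Meets {A = A} {B} d m)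

  mated : ∀ {n k′} (sets : List (Subset n)) → Unique sets → (∀ {A} → A ∈ sets → ∣ A ∣ ≡ suc k′) →
    (∀ {A B D} → A ∈ sets → B ∈ sets → D ∈ sets → Disj A B → Disj D B → A ≢ D → Disj A D) →
    MatedFamily n (suc k′)
  mated {n} sets unique size transitive = record
    { sets = sets
    ; unique = unique
    ; size = size
    ; nonempty = λ {A} A∈ → size⇒nonempty {A = A} (size A∈)
    ; transitive = λ {A} {B} {D} → transitive {A} {B} {D}
    ; isolated = isolated
    ; isolated-meets = λ {A} {B} → isolated-meets A B
    ; mate = mate
    ; mate∈ = λ {A} _ → mate∈ A
    ; mate-disj = λ {A} _ → mate-disj A
    }
    where
    isolated : Subset n → Bool
    isolated A with any? (disj? A) sets
    ... | yes _ = false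
    ... | no _ = true
    mate : Subset n → Subset n
    mate A with any? (disj? A) sets
    ... | yes some = proj₁ (find some)
    -- A default for isolated sets; `leading`, `leading₂` and `leadingEnd` consult the mate under
    -- the guard `not (isolated A)`.
    ... | no _ = A
    isolated-meets : ∀ A B → A ∈ sets → B ∈ sets → isolated A ≡ true → Meets A B
    isolated-meets A B A∈ B∈ iso with any? (disj? A) sets
    ... | no none-disj with disj-or-meets A B
    ...   | inj₁ d = ⊥-elim (none-disj (lose B∈ d))
    ...   | inj₂ m = m
    mate∈ : ∀ A → isolated A ≡ false → mate A ∈ sets
    mate∈ A iso with any? (disj? A) sets
    ... | yes some = proj₁ (proj₂ (find some))
    mate-disj : ∀ A → isolated A ≡ false → Disj A (mate A)
    mate-disj A iso with any? (disj? A) sets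
    ... | yes some = proj₂ (proj₂ (find some))

  ∩≡∅⇒Disj : ∀ {n} {A B : Subset n} → A ∩ B ≡ ∅ → Disj A B
  ∩≡∅⇒Disj {A = A} {B} eq x Ax with lookup B x in Bx
  ... | false = refl
  ... | true = ⊥-elim (∉⊥ (subst (x ∈ˢ_) eq (x∈p∩q⁺ (lookup⇒[]= x A Ax , lookup⇒[]= x B Bx))))

  Disj⇒∩≡∅ : ∀ {n} {A B : Subset n} → Disj A B → A ∩ B ≡ ∅
  Disj⇒∩≡∅ {A = A} {B} d = Empty-unique (λ (x , x∈) → let x∈A , x∈B = x∈p∩q⁻ A B x∈ in
    true≢false ([]=⇒lookup x∈B) (d x ([]=⇒lookup x∈A)))

open WeightedCycles
open import Data.Fin using (_<_)

theorem4 : (n k h : ℕ) → 2 * k + 2 ≤ n → 4 ≤ k →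
    (𝓕 : Fin h → Family n) →
    (∀ i → Unique (𝓕 i)) →
    (∀ i → IsKUniform k (𝓕 i)) →
    (∀ i j → i < j → DisjointFamilies (𝓕 i) (𝓕 j)) →
    (∀ i → PairwiseDisjointMembers (𝓕 i)) →
    (∀ i j → i < j → CrossIntersecting (𝓕 i) (𝓕 j)) →
    totalSize 𝓕 ≤ (n ∸ 1) C (k ∸ 1)
theorem4 n k h 2k+2≤n 4≤k 𝓕 unique uniform disjoint pairwise cross
  with m≤n⇒∃[o]m+o≡n 4≤k
... | c , refl with m≤n⇒∃[o]m+o≡n 2k+2≤n
-- This brings n into the form k + (r + k′) with k′ = 3 + c and r = n - 2k + 1 = 3 + d.
... | d , n≡ with ≡-trans (sym (resplit c d)) n≡
  where
  resplit : ∀ c d → 2 * (4 + c) + 2 + d ≡ 4 + c + (3 + d + (3 + c))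
  resplit = solve-∀
... | refl = subst (_≤ (3 + c + (3 + d + (3 + c))) C (3 + c)) total (mated-bound c d
    (mated sets unique-sets size transitive))
  where
  sets : Family (4 + c + (3 + d + (3 + c)))
  sets = concatMap 𝓕 (allFin h)
  total : length sets ≡ totalSize 𝓕
  total = begin
    length sets
      ≡⟨ *-identityʳ _ ⟨
    length sets * 1
      ≡⟨ ∑-const sets 1 ⟨
    ∑ sets (λ _ → 1)
      ≡⟨ ∑-concatMap 𝓕 (allFin h) _ ⟩
    ∑ (allFin h) (λ i → ∑ (𝓕 i) (λ _ → 1))
      ≡⟨ ∑-cong (allFin h) (λ i → ≡-trans (∑-const (𝓕 i) 1) (*-identityʳ _)) ⟩
    totalSize 𝓕 ∎
    where open ≡-Reasoning
  index : ∀ {A} → A ∈ sets → ∃ λ i → A ∈ 𝓕 i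
  index {A} A∈ with find (∈-concatMap⁻ 𝓕 {xs = allFin h} A∈)
  ... | i , _ , A∈𝓕i = i , A∈𝓕i
  unique-sets : Unique sets
  unique-sets = concat⁺ (All.map⁺ (All.tabulate (λ {i} _ → unique i)))
    (AllPairs.map⁺ (AllPairs.tabulate⁺-< (λ {i} {j} i<j (A∈i , A∈j) → disjoint i j i<j _ A∈i A∈j)))
  size : ∀ {A} → A ∈ sets → ∣ A ∣ ≡ 4 + c
  size A∈ with index A∈
  ... | i , A∈𝓕i = All.lookup (uniform i) A∈𝓕i
  same-family : ∀ {A B i j} → A ∈ 𝓕 i → B ∈ 𝓕 j → Disj A B → i ≡ j
  same-family {A} {B} {i} {j} A∈ B∈ dis with Fin.<-cmp i j
  ... | tri≈ _ eq _ = eq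
  ... | tri< i<j _ _ = ⊥-elim (cross i j i<j A B A∈ B∈ (Disj⇒∩≡∅ {A = A} {B} dis))
  ... | tri> _ _ j<i = ⊥-elim (cross j i j<i B A B∈ A∈ (Disj⇒∩≡∅ {A = B} {A} (Disj-sym {A = A} {B} dis)))
  -- Cross-intersection puts `A`, `B` and `D` into one family, whose distinct members are pairwise
  -- disjoint.
  transitive : ∀ {A B D} → A ∈ sets → B ∈ sets → D ∈ sets → Disj A B → Disj D B → A ≢ D → Disj A D
  transitive {A} {B} {D} A∈ B∈ D∈ dAB dDB A≢D with index A∈ | index B∈ | index D∈
  ... | i , A∈i | j , B∈j | l , D∈l
    with same-family {A} {B} A∈i B∈j dAB | same-family {D} {B} D∈l B∈j dDB
  ...   | refl | refl = ∩≡∅⇒Disj {A = A} {D} (pairwise i A D A∈i D∈l A≢D)
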